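{- There exists a constant $C>0$ such that for every positive integer $n$ there is a maximal Sidon set $S\subseteq\mathbb{Z}_2^n$ with $|S|\le C\,(n\cdot 2^n)^{1/3}$; that is, $|S|=O\big((n\cdot 2^n)^{1/3}\big)$.
   Context: A subset $S\subseteq\mathbb{Z}_2^n$ is called Sidon if whenever $a+b=x+y$ with $a,b,x,y\in S$, $a\neq b$, $x\neq y$, we have $\{a,b\}=\{x,y\}$ (i.e. the sums of pairs of distinct elements of $S$ are all distinct). A Sidon set $S$ is maximal if there is no Sidon set $S'\subseteq\mathbb{Z}_2^n$ with $S\subsetneq S'$. -}

module Defs where

open import Data.Bool using (Bool; _xor_)
open import Data.Nat using (ℕ; _*_; _^_; _≤_)
open import Data.Vec using (Vec; zipWith)
open import Data.List using (List; length)
open import Data.List.Membership.Propositional using (_∈_; _∉_)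
open import Data.List.Relation.Unary.Unique.Propositional using (Unique)
open import Data.Product using (_×_; ∃-syntax)
open import Data.Sum using (_⊎_)
open import Data.Empty using (⊥)
open import Relation.Binary.PropositionalEquality using (_≡_; _≢_)

Z2^ : ℕ → Set
Z2^ n = Vec Bool n

_⊕_ : ∀ {n} → Z2^ n → Z2^ n → Z2^ n
_⊕_ = zipWith _xor_

-- A finite subset of Z_2^n is represented by a list; membership is list membership.
-- Sidon: sums of pairs of distinct elements are distinct as pairs.
IsSidon : ∀ {n} → List (Z2^ n) → Set
IsSidon S = ∀ {a b x y} → a ∈ S → b ∈ S → x ∈ S → y ∈ S →
  a ≢ b → x ≢ y → a ⊕ b ≡ x ⊕ y →
  (a ≡ x × b ≡ y) ⊎ (a ≡ y × b ≡ x)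

_⊆ₛ_ : ∀ {n} → List (Z2^ n) → List (Z2^ n) → Set
S ⊆ₛ S' = ∀ {v} → v ∈ S → v ∈ S'

_⊂ₛ_ : ∀ {n} → List (Z2^ n) → List (Z2^ n) → Set
S ⊂ₛ S' = S ⊆ₛ S' × ∃[ v ] (v ∈ S' × v ∉ S)

IsMaximalSidon : ∀ {n} → List (Z2^ n) → Set
IsMaximalSidon {n} S = IsSidon S × (∀ (S' : List (Z2^ n)) → S ⊂ₛ S' → IsSidon S' → ⊥)

{-# OPTIONS --safe #-}
-- Let k be odd, K the field with 2^k elements and m = 2k + r. The curve of the points
-- (x, x³) is a Sidon set in K², and every (s, t) with t ≠ s³ is the sum of three points of
-- the curve in at least (2^k - 2)/6 ways, any two of which are disjoint. Lift the curve by
-- a function f : K → ℤ₂^r to the Sidon set of the points (x, x³, f x) in ℤ₂^m. For a random f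
-- each of these triples has the third coordinate w with probability 2^-r, and disjoint
-- triples are independent; so if 2^k exceeds a multiple of m 2^r, some f makes every
-- (s, t, w) with t ≠ s³ a sum of three lifted points. A maximal Sidon set S containing
-- the lift then lies over the curve. Two points of S over the same x differ by some (0, 0, d),
-- and d ≠ 0 occurs for at most one x, so |S| ≤ 2^k + 2^r. Taking 2^(3k) of the order
-- of m 2^m gives the bound.
--
-- K is constructed as 𝔽₂[X]/P, where P is an irreducible factor of X^(2^k) + X dividing no
-- X^(2^d) + X with 0 < d < k. Such a P exists since X^(2^k) + X is squarefree and its
-- degree exceeds that of the product of the smaller ones. Its degree is k: P has
-- the k distinct roots X, X², X⁴, ..., and all elements of K are roots of X^(2^k) + X.

module Submission where

-- A point is blocked from a Sidon set once it is a sum of three points already present, so N points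
-- block at most about N³/6 points. The random lift costs a further factor of order m; this is why
-- 2^(3k) has to be of order m 2^m.
--
-- The triples for (s, t) come from a shift by s: the points s + x, s + xu, s + x(u + 1) sum to s,
-- and their cubes sum to s³ + x³(u² + u). For each ratio u other than 0 and 1, finding x means
-- taking a cube root, and this is always possible because 3 is prime to 2^k - 1 for odd k. Each
-- triple has at most six ratios.
--
-- The random choice of f is made deterministic: the points of K are coloured one by one, each
-- colour keeping a weighted count of the unmet demands at or below its average. Probabilities are
-- multiplied out to inequalities in ℕ, and each triple is charged to the last of its points in a
-- fixed order of K.
--
-- If m < 2k there is no room for a lift. This happens only below a fixed dimension, where any
-- maximal Sidon set will do.

open import Defs
open import Level using (0ℓ)
open import Algebra using (CommutativeSemiring; RawRing)
open import Algebra.Solver.Ring.AlmostCommutativeRing using (fromCommutativeSemiring; _-Raw-AlmostCommutative⟶_)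
import Algebra.Solver.Ring
open import Data.Bool using (Bool; true; false; _xor_; _∧_; if_then_else_)
import Data.Bool
open import Data.Bool.Properties using (xor-comm; xor-assoc; xor-same; xor-identityʳ; ∧-zeroʳ)
open import Data.Empty using (⊥; ⊥-elim)
open import Data.Fin using (toℕ)
open import Data.List as List using (List; []; _∷_; _++_; length; map; filter)
open import Data.List.Membership.Propositional using (_∈_; _∉_; find; lose)
open import Data.List.Membership.Propositional.Properties using (∈-filter⁺; ∈-filter⁻; ∈-map⁺; ∈-map⁻; ∈-++⁺ˡ; ∈-++⁺ʳ)
open import Data.List.Properties using (length-map; length-++; length-filter; length-replicate; length-applyUpTo)
open import Data.List.Relation.Unary.All as All using (All; []; _∷_; all?)
import Data.List.Relation.Unary.All.Properties as Allₚ
open import Data.List.Relation.Unary.AllPairs using ([]; _∷_)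
open import Data.List.Relation.Unary.Any as Any using (Any; here; there; any?; satisfied)
open import Data.List.Relation.Unary.Unique.Propositional using (Unique)
import Data.List.Relation.Unary.Unique.Propositional.Properties as Uniqueₚ
open import Data.Maybe using (Maybe; just; nothing)
open import Data.Nat using (ℕ; zero; suc; pred; _+_; _*_; _∸_; _^_; _≤_; _<_; z≤n; s≤s; NonZero; >-nonZero; _≤?_; _<?_)
open import Data.Nat.Induction using (<-wellFounded)
open import Data.Nat.ListAction using (sum)
open import Data.Nat.Properties
open import Data.Nat.Tactic.RingSolver using (solve-∀)
open import Data.Product using (Σ; ∃; ∃-syntax; _,_; _×_; proj₁; proj₂)
open import Data.Sum using (_⊎_; inj₁; inj₂)
open import Data.Sum.Properties using (inj₁-injective; inj₂-injective)
open import Data.Vec as Vec using (Vec; []; _∷_; toList; replicate; take; drop)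
open import Data.Vec.Properties using (≡-dec; take++drop≡id; ++-injective; ++-injectiveˡ; ∷-injectiveʳ; length-toList; zipWith-++; zipWith-assoc; zipWith-comm; zipWith-identityˡ; zipWith-identityʳ)
open import Function using (_∘_; id)
open import Induction.WellFounded using (Acc; acc)
open import Relation.Binary using (Setoid; tri<; tri≈; tri>)
import Relation.Binary.Reasoning.Setoid
open import Relation.Binary.PropositionalEquality using (_≡_; _≢_; refl; sym; trans; cong; cong₂; subst; subst₂; isEquivalence; module ≡-Reasoning)
open import Relation.Nullary using (Dec; yes; no; ¬_; ¬?)
open import Relation.Nullary.Decidable using (map′; _×-dec_; _⊎-dec_; _→-dec_)

-- Polynomials over 𝔽₂

-- A semiring with 1 + 1 = 0 is a commutative 𝔽₂-algebra, so the ring solver can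
-- use 𝔽₂ as coefficients; it then decides all identities in characteristic 2.
module Char2Solver (A : CommutativeSemiring 0ℓ 0ℓ)
  (char2 : CommutativeSemiring._≈_ A
    (CommutativeSemiring._+_ A (CommutativeSemiring.1# A) (CommutativeSemiring.1# A))
    (CommutativeSemiring.0# A)) where

  private
    module A = CommutativeSemiring A

  bits : RawRing 0ℓ 0ℓ
  bits = record { Carrier = Bool ; _≈_ = _≡_ ; _+_ = _xor_ ; _*_ = _∧_ ; -_ = id ; 0# = false ; 1# = true }

  embed : Bool → A.Carrier
  embed b = if b then A.1# else A.0#

  embed-+ : ∀ a b → embed (a xor b) A.≈ embed a A.+ embed b
  embed-+ false b = A.sym (A.+-identityˡ _)
  embed-+ true false = A.sym (A.+-identityʳ _)
  embed-+ true true = A.sym char2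

  embed-* : ∀ a b → embed (a ∧ b) A.≈ embed a A.* embed b
  embed-* false b = A.sym (A.zeroˡ _)
  embed-* true b = A.sym (A.*-identityˡ _)

  morphism : bits -Raw-AlmostCommutative⟶ fromCommutativeSemiring A
  morphism = record
    { ⟦_⟧ = embed ; +-homo = embed-+ ; *-homo = embed-* ; -‿homo = λ _ → A.refl ; 0-homo = A.refl ; 1-homo = A.refl }

  coeff≟ : ∀ a b → Maybe (embed a A.≈ embed b)
  coeff≟ false false = just A.refl
  coeff≟ true true = just A.refl
  coeff≟ _ _ = nothing

  open Algebra.Solver.Ring bits (fromCommutativeSemiring A) morphism coeff≟ public
    using (solve; _:+_; _:*_; _:=_; con)

Poly : Set
Poly = List Bool

coef : Poly → ℕ → Bool
coef [] _ = false
coef (a ∷ p) zero = a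
coef (a ∷ p) (suc i) = coef p i

infix 4 _≈_
-- Lists may end in zeros, so equality is that of coefficients. As a record it lets `p` and `q` be
-- inferred from a proof.
record _≈_ (p q : Poly) : Set where
  constructor mk≈
  field at : ∀ i → coef p i ≡ coef q i
open _≈_

infixl 6 _+ₚ_
infixl 7 _*ₚ_ _·ₚ_

_+ₚ_ : Poly → Poly → Poly
[] +ₚ q = q
(a ∷ p) +ₚ [] = a ∷ p
(a ∷ p) +ₚ (b ∷ q) = (a xor b) ∷ (p +ₚ q)

_·ₚ_ : Bool → Poly → Poly
b ·ₚ p = if b then p else []

_*ₚ_ : Poly → Poly → Poly
[] *ₚ q = []
(a ∷ p) *ₚ q = a ·ₚ q +ₚ (false ∷ p *ₚ q)

1ₚ X : Poly
1ₚ = true ∷ []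
X = false ∷ true ∷ []

≈-refl : ∀ {p} → p ≈ p
≈-refl = mk≈ λ _ → refl

≈-sym : ∀ {p q} → p ≈ q → q ≈ p
≈-sym e = mk≈ λ i → sym (at e i)

≈-trans : ∀ {p q r} → p ≈ q → q ≈ r → p ≈ r
≈-trans e f = mk≈ λ i → trans (at e i) (at f i)

≈-reflexive : ∀ {p q} → p ≡ q → p ≈ q
≈-reflexive refl = ≈-refl

polySetoid : Setoid 0ℓ 0ℓ
polySetoid = record { Carrier = Poly ; _≈_ = _≈_ ; isEquivalence = record { refl = ≈-refl ; sym = ≈-sym ; trans = ≈-trans } }

module ≈-Reasoning = Relation.Binary.Reasoning.Setoid polySetoid

coef-+ : ∀ p q i → coef (p +ₚ q) i ≡ coef p i xor coef q i
coef-+ [] q i = refl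
coef-+ (a ∷ p) [] i = sym (xor-identityʳ _)
coef-+ (a ∷ p) (b ∷ q) zero = refl
coef-+ (a ∷ p) (b ∷ q) (suc i) = coef-+ p q i

coef-· : ∀ b p i → coef (b ·ₚ p) i ≡ b ∧ coef p i
coef-· false p i = refl
coef-· true p i = refl

∷-cong : ∀ {a p q} → p ≈ q → a ∷ p ≈ a ∷ q
∷-cong e = mk≈ λ { zero → refl ; (suc i) → at e i }

false∷[] : false ∷ [] ≈ []
false∷[] = mk≈ λ { zero → refl ; (suc i) → refl }

+ₚ-cong : ∀ {p q r s} → p ≈ q → r ≈ s → p +ₚ r ≈ q +ₚ s
+ₚ-cong {p} {q} {r} {s} e f = mk≈ λ i →
  trans (coef-+ p r i) (trans (cong₂ _xor_ (at e i) (at f i)) (sym (coef-+ q s i)))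

+ₚ-comm : ∀ p q → p +ₚ q ≈ q +ₚ p
+ₚ-comm p q = mk≈ λ i → trans (coef-+ p q i) (trans (xor-comm (coef p i) _) (sym (coef-+ q p i)))

+ₚ-assoc : ∀ p q r → (p +ₚ q) +ₚ r ≈ p +ₚ (q +ₚ r)
+ₚ-assoc p q r = mk≈ λ i →
  trans (coef-+ (p +ₚ q) r i) (trans (cong (_xor coef r i) (coef-+ p q i))
  (trans (xor-assoc (coef p i) _ _) (sym (trans (coef-+ p (q +ₚ r) i) (cong (coef p i xor_) (coef-+ q r i))))))

+ₚ-identityʳ : ∀ p → p +ₚ [] ≡ p
+ₚ-identityʳ [] = refl
+ₚ-identityʳ (a ∷ p) = refl

+ₚ-self : ∀ p → p +ₚ p ≈ []
+ₚ-self p = mk≈ λ i → trans (coef-+ p p i) (xor-same (coef p i))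

+ₚ-interchange : ∀ p q r s → (p +ₚ q) +ₚ (r +ₚ s) ≈ (p +ₚ r) +ₚ (q +ₚ s)
+ₚ-interchange p q r s = begin
  (p +ₚ q) +ₚ (r +ₚ s) ≈⟨ +ₚ-assoc p q _ ⟩
  p +ₚ (q +ₚ (r +ₚ s)) ≈⟨ +ₚ-cong (≈-refl {p}) (+ₚ-assoc q r s) ⟨
  p +ₚ ((q +ₚ r) +ₚ s) ≈⟨ +ₚ-cong (≈-refl {p}) (+ₚ-cong (+ₚ-comm q r) (≈-refl {s})) ⟩
  p +ₚ ((r +ₚ q) +ₚ s) ≈⟨ +ₚ-cong (≈-refl {p}) (+ₚ-assoc r q s) ⟩
  p +ₚ (r +ₚ (q +ₚ s)) ≈⟨ +ₚ-assoc p r _ ⟨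
  (p +ₚ r) +ₚ (q +ₚ s) ∎
  where open ≈-Reasoning

·ₚ-cong : ∀ b {p q} → p ≈ q → b ·ₚ p ≈ b ·ₚ q
·ₚ-cong false e = ≈-refl
·ₚ-cong true e = e

·ₚ-distribˡ : ∀ b p q → b ·ₚ (p +ₚ q) ≈ b ·ₚ p +ₚ b ·ₚ q
·ₚ-distribˡ false p q = ≈-refl
·ₚ-distribˡ true p q = ≈-refl

*ₚ-congˡ : ∀ p {q r} → q ≈ r → p *ₚ q ≈ p *ₚ r
*ₚ-congˡ [] e = ≈-refl
*ₚ-congˡ (a ∷ p) e = +ₚ-cong (·ₚ-cong a e) (∷-cong (*ₚ-congˡ p e))

*ₚ-zeroʳ : ∀ p → p *ₚ [] ≈ []
*ₚ-zeroʳ [] = ≈-refl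
*ₚ-zeroʳ (false ∷ p) = ≈-trans (∷-cong (*ₚ-zeroʳ p)) false∷[]
*ₚ-zeroʳ (true ∷ p) = ≈-trans (∷-cong (*ₚ-zeroʳ p)) false∷[]

*ₚ-distribˡ : ∀ p q r → p *ₚ (q +ₚ r) ≈ p *ₚ q +ₚ p *ₚ r
*ₚ-distribˡ [] q r = ≈-refl
*ₚ-distribˡ (a ∷ p) q r = ≈-trans
  (+ₚ-cong (·ₚ-distribˡ a q r) (∷-cong (*ₚ-distribˡ p q r)))
  (+ₚ-interchange (a ·ₚ q) (a ·ₚ r) (false ∷ p *ₚ q) (false ∷ p *ₚ r))

·ₚ-singleton : ∀ a b → a ·ₚ (b ∷ []) ≈ (a ∧ b) ∷ []
·ₚ-singleton false b = ≈-sym false∷[]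
·ₚ-singleton true b = ≈-refl

*ₚ-shiftʳ : ∀ p q → p *ₚ (false ∷ q) ≈ false ∷ p *ₚ q
*ₚ-shiftʳ [] q = ≈-sym false∷[]
*ₚ-shiftʳ (false ∷ p) q = ∷-cong (*ₚ-shiftʳ p q)
*ₚ-shiftʳ (true ∷ p) q = ∷-cong (+ₚ-cong (≈-refl {q}) (*ₚ-shiftʳ p q))

*ₚ-singletonʳ : ∀ p b → p *ₚ (b ∷ []) ≈ b ·ₚ p
*ₚ-singletonʳ p false = ≈-trans (*ₚ-congˡ p false∷[]) (*ₚ-zeroʳ p)
*ₚ-singletonʳ [] true = ≈-refl
*ₚ-singletonʳ (a ∷ p) true = ≈-trans (+ₚ-cong (·ₚ-singleton a true) (∷-cong (*ₚ-singletonʳ p true)))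
  (mk≈ λ { zero → lem a ; (suc i) → refl })
  where
  lem : ∀ a → (a ∧ true) xor false ≡ a
  lem false = refl
  lem true = refl

∷-split : ∀ b q → b ∷ q ≡ (b ∷ []) +ₚ (false ∷ q)
∷-split b q = cong (_∷ q) (sym (xor-identityʳ b))

*ₚ-∷ʳ : ∀ p b q → p *ₚ (b ∷ q) ≈ b ·ₚ p +ₚ (false ∷ p *ₚ q)
*ₚ-∷ʳ p b q = begin
  p *ₚ (b ∷ q)                          ≡⟨ cong (p *ₚ_) (∷-split b q) ⟩
  p *ₚ ((b ∷ []) +ₚ (false ∷ q))        ≈⟨ *ₚ-distribˡ p (b ∷ []) (false ∷ q) ⟩
  p *ₚ (b ∷ []) +ₚ p *ₚ (false ∷ q)     ≈⟨ +ₚ-cong (*ₚ-singletonʳ p b) (*ₚ-shiftʳ p q) ⟩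
  b ·ₚ p +ₚ (false ∷ p *ₚ q)            ∎
  where open ≈-Reasoning

*ₚ-comm : ∀ p q → p *ₚ q ≈ q *ₚ p
*ₚ-comm [] q = ≈-sym (*ₚ-zeroʳ q)
*ₚ-comm (a ∷ p) q = ≈-trans (+ₚ-cong (≈-refl {a ·ₚ q}) (∷-cong (*ₚ-comm p q))) (≈-sym (*ₚ-∷ʳ q a p))

*ₚ-cong : ∀ {p q r s} → p ≈ q → r ≈ s → p *ₚ r ≈ q *ₚ s
*ₚ-cong {p} {q} {r} {s} e f = begin
  p *ₚ r ≈⟨ *ₚ-congˡ p f ⟩
  p *ₚ s ≈⟨ *ₚ-comm p s ⟩
  s *ₚ p ≈⟨ *ₚ-congˡ s e ⟩
  s *ₚ q ≈⟨ *ₚ-comm s q ⟩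
  q *ₚ s ∎
  where open ≈-Reasoning

*ₚ-distribʳ : ∀ r p q → (p +ₚ q) *ₚ r ≈ p *ₚ r +ₚ q *ₚ r
*ₚ-distribʳ r p q = ≈-trans (*ₚ-comm (p +ₚ q) r) (≈-trans (*ₚ-distribˡ r p q)
  (+ₚ-cong (*ₚ-comm r p) (*ₚ-comm r q)))

·ₚ-*ₚ : ∀ a q r → (a ·ₚ q) *ₚ r ≡ a ·ₚ (q *ₚ r)
·ₚ-*ₚ false q r = refl
·ₚ-*ₚ true q r = refl

*ₚ-assoc : ∀ p q r → (p *ₚ q) *ₚ r ≈ p *ₚ (q *ₚ r)
*ₚ-assoc [] q r = ≈-refl
*ₚ-assoc (a ∷ p) q r = begin
  (a ·ₚ q +ₚ (false ∷ p *ₚ q)) *ₚ r         ≈⟨ *ₚ-distribʳ r (a ·ₚ q) _ ⟩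
  (a ·ₚ q) *ₚ r +ₚ (false ∷ (p *ₚ q) *ₚ r)  ≈⟨ +ₚ-cong (≈-reflexive (·ₚ-*ₚ a q r)) (∷-cong (*ₚ-assoc p q r)) ⟩
  a ·ₚ (q *ₚ r) +ₚ (false ∷ p *ₚ (q *ₚ r))  ∎
  where open ≈-Reasoning

*ₚ-identityˡ : ∀ p → 1ₚ *ₚ p ≈ p
*ₚ-identityˡ p = ≈-trans (+ₚ-cong (≈-refl {p}) false∷[]) (≈-reflexive (+ₚ-identityʳ p))

polySemiring : CommutativeSemiring 0ℓ 0ℓ
polySemiring = record
  { Carrier = Poly ; _≈_ = _≈_ ; _+_ = _+ₚ_ ; _*_ = _*ₚ_ ; 0# = [] ; 1# = 1ₚ
  ; isCommutativeSemiring = record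
    { isSemiring = record
      { isSemiringWithoutAnnihilatingZero = record
        { +-isCommutativeMonoid = record
          { isMonoid = record
            { isSemigroup = record
              { isMagma = record { isEquivalence = Setoid.isEquivalence polySetoid ; ∙-cong = +ₚ-cong }
              ; assoc = +ₚ-assoc }
            ; identity = (λ _ → ≈-refl) , λ p → ≈-reflexive (+ₚ-identityʳ p) }
          ; comm = +ₚ-comm }
        ; *-cong = *ₚ-cong
        ; *-assoc = *ₚ-assoc
        ; *-identity = *ₚ-identityˡ , λ p → ≈-trans (*ₚ-comm p 1ₚ) (*ₚ-identityˡ p)
        ; distrib = *ₚ-distribˡ , *ₚ-distribʳ }
      ; zero = (λ _ → ≈-refl) , *ₚ-zeroʳ }
    ; *-comm = *ₚ-comm } }

module PolySolver = Char2Solver polySemiring (+ₚ-self 1ₚ)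

-- Degrees and division with remainder

module _ where
  open PolySolver using (solve; _:+_; _:*_; _:=_; con)

  -- A relation and not a function: trailing zeros hide the degree, and the zero polynomial has
  -- none.
  record HasDegree (p : Poly) (d : ℕ) : Set where
    constructor degree
    field
      leading : coef p d ≡ true
      above : ∀ i → d < i → coef p i ≡ false
  open HasDegree

  degree-cong : ∀ {p q d} → p ≈ q → HasDegree p d → HasDegree q d
  degree-cong e (degree t z) = degree (trans (sym (at e _)) t) λ i l → trans (sym (at e i)) (z i l)

  degree-unique : ∀ {p d e} → HasDegree p d → HasDegree p e → d ≡ e
  degree-unique {p} {d} {e} (degree t z) (degree t' z') with <-cmp d e
  ... | tri≈ _ refl _ = refl
  ... | tri< l _ _ with () ← trans (sym t') (z e l)
  ... | tri> _ _ l with () ← trans (sym t) (z' d l)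

  degree≉0 : ∀ {p d} → HasDegree p d → ¬ (p ≈ [])
  degree≉0 h e with () ← trans (sym (leading h)) (at e _)

  ∷-degree : ∀ {a p d} → HasDegree p d → HasDegree (a ∷ p) (suc d)
  ∷-degree (degree t z) = degree t λ { (suc i) (s≤s l) → z i l }

  zeroOrDegree : ∀ p → (p ≈ []) ⊎ ∃ (HasDegree p)
  zeroOrDegree [] = inj₁ ≈-refl
  zeroOrDegree (a ∷ p) with zeroOrDegree p
  ... | inj₂ (d , h) = inj₂ (suc d , ∷-degree h)
  zeroOrDegree (true ∷ p) | inj₁ e = inj₂ (0 , degree refl λ { (suc i) _ → at e i })
  zeroOrDegree (false ∷ p) | inj₁ e = inj₁ (mk≈ λ { zero → refl ; (suc i) → at e i })

  +ₚ-degree : ∀ {p q d} → HasDegree p d → (∀ i → d ≤ i → coef q i ≡ false) → HasDegree (q +ₚ p) d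
  +ₚ-degree {p} {q} {d} (degree t z) small = degree
    (trans (coef-+ q p d) (cong₂ _xor_ (small d ≤-refl) t))
    λ i l → trans (coef-+ q p i) (cong₂ _xor_ (small i (<⇒≤ l)) (z i l))

  *ₚ-degree : ∀ {p q d e} → HasDegree p d → HasDegree q e → HasDegree (p *ₚ q) (d + e)
  *ₚ-degree {[]} (degree () _)
  *ₚ-degree {a ∷ p} {q} {zero} {e} (degree refl z) h = degree-cong
    (begin
      q                     ≡⟨ +ₚ-identityʳ q ⟨
      q +ₚ []               ≈⟨ +ₚ-cong (≈-refl {q}) (≈-trans (≈-sym false∷[]) (∷-cong (*ₚ-cong {[]} {p} {q} (≈-sym p≈0) ≈-refl))) ⟩
      q +ₚ (false ∷ p *ₚ q) ∎)
    h
    where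
    open ≈-Reasoning
    p≈0 : p ≈ []
    p≈0 = mk≈ λ i → z (suc i) (s≤s z≤n)
  *ₚ-degree {a ∷ p} {q} {suc d} {e} (degree t z) h =
    +ₚ-degree {false ∷ p *ₚ q} {a ·ₚ q} (∷-degree (*ₚ-degree {p} {q} (degree t λ i l → z (suc i) (s≤s l)) h))
      (λ i l → trans (coef-· a q i) (trans (cong (a ∧_) (above h i (≤-trans (s≤s (m≤n+m e d)) l))) (∧-zeroʳ a)))

  monic : ∀ {e} → Vec Bool e → Poly
  monic v = toList v ++ (true ∷ [])

  low : ∀ {e} → Vec Bool e → Poly
  low = toList

  monic-degree : ∀ {e} (v : Vec Bool e) → HasDegree (monic v) e
  monic-degree [] = degree refl λ { (suc i) _ → refl }
  monic-degree (a ∷ v) = ∷-degree (monic-degree v)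

  low-coef : ∀ {e} (v : Vec Bool e) i → e ≤ i → coef (low v) i ≡ false
  low-coef [] i l = refl
  low-coef (a ∷ v) (suc i) (s≤s l) = low-coef v i l

  low-degree : ∀ {e} (v : Vec Bool e) {d} → HasDegree (low v) d → d < e
  low-degree {e} v {d} (degree t _) with d <? e
  ... | yes l = l
  ... | no l with () ← trans (sym t) (low-coef v d (≮⇒≥ l))

  low-injective : ∀ {e} (v w : Vec Bool e) → low v ≈ low w → v ≡ w
  low-injective [] [] e = refl
  low-injective (a ∷ v) (b ∷ w) e = cong₂ _∷_ (at e 0) (low-injective v w (mk≈ λ i → at e (suc i)))

  low-⊕ : ∀ {e} (v w : Vec Bool e) → low (v ⊕ w) ≡ low v +ₚ low w
  low-⊕ [] [] = refl
  low-⊕ (a ∷ v) (b ∷ w) = cong (_ ∷_) (low-⊕ v w)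

  0# : ∀ {e} → Vec Bool e
  0# = replicate _ false

  low-0 : ∀ e → low (0# {e}) ≈ []
  low-0 zero = ≈-refl
  low-0 (suc e) = ≈-trans (∷-cong (low-0 e)) false∷[]

  firstCoefs : ∀ d → Poly → Vec Bool d
  firstCoefs d p = Vec.tabulate (λ i → coef p (toℕ i))

  toMonic : ∀ p {d} → HasDegree p d → p ≈ monic (firstCoefs d p)
  toMonic [] (degree () _)
  toMonic (a ∷ p) {zero} (degree t z) = mk≈ λ { zero → t ; (suc i) → z (suc i) (s≤s z≤n) }
  toMonic (a ∷ p) {suc d} (degree t z) = ∷-cong (toMonic p (degree t λ i l → z (suc i) (s≤s l)))

  -- One step of long division. The top coefficient sits at the end of the vector: the recursion
  -- fetches it and subtracts that multiple of `v` on the way back.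
  reduce : ∀ {e} → Vec Bool (suc e) → Vec Bool e → Bool × Vec Bool e
  reduce (a ∷ []) [] = a , []
  reduce (a ∷ w@(_ ∷ _)) (b ∷ v) = let t , r = reduce w v in t , (a xor (t ∧ b)) ∷ r

  reduce-spec : ∀ {e} (w : Vec Bool (suc e)) (v : Vec Bool e) →
    low w ≈ proj₁ (reduce w v) ·ₚ monic v +ₚ low (proj₂ (reduce w v))
  reduce-spec (true ∷ []) [] = ≈-refl
  reduce-spec (false ∷ []) [] = false∷[]
  reduce-spec (a ∷ w@(_ ∷ _)) (b ∷ v) with reduce w v | reduce-spec w v
  ... | true , r | h = mk≈ λ { zero → trans (sym (xor-cancel a b)) refl ; (suc i) → at h i }
    where
    xor-cancel : ∀ a b → b xor (a xor b) ≡ a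
    xor-cancel true true = refl
    xor-cancel true false = refl
    xor-cancel false true = refl
    xor-cancel false false = refl
  ... | false , r | h = mk≈ λ { zero → sym (xor-identityʳ a) ; (suc i) → at h i }

  divMod : ∀ {e} → Vec Bool e → Poly → Poly × Vec Bool e
  divMod v [] = [] , 0#
  divMod v (a ∷ p) = let q , r = divMod v p ; t , r' = reduce (a ∷ r) v in t ∷ q , r'

  rem : ∀ {e} → Vec Bool e → Poly → Vec Bool e
  rem v p = proj₂ (divMod v p)

  divMod-spec : ∀ {e} (v : Vec Bool e) p → p ≈ proj₁ (divMod v p) *ₚ monic v +ₚ low (rem v p)
  divMod-spec {e} v [] = ≈-sym (low-0 e)
  divMod-spec v (a ∷ p) with divMod v p | divMod-spec v p
  ... | q , r | h with reduce (a ∷ r) v | reduce-spec (a ∷ r) v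
  ... | t , r' | h' = begin
    a ∷ p                                           ≈⟨ ∷-cong h ⟩
    a ∷ (q *ₚ m +ₚ low r)                           ≡⟨⟩
    (false ∷ q *ₚ m) +ₚ (a ∷ low r)                 ≈⟨ +ₚ-cong (≈-refl {false ∷ q *ₚ m}) h' ⟩
    (false ∷ q *ₚ m) +ₚ (t ·ₚ m +ₚ low r')          ≈⟨ solve 3 (λ x y z → x :+ (y :+ z) := y :+ x :+ z) ≈-refl (false ∷ q *ₚ m) (t ·ₚ m) (low r') ⟩
    t ·ₚ m +ₚ (false ∷ q *ₚ m) +ₚ low r'            ∎
    where
    open ≈-Reasoning
    m = monic v

  -- Divisibility and irreducible polynomials

  infix 4 _∣_
  _∣_ : Poly → Poly → Set
  p ∣ q = ∃[ c ] q ≈ c *ₚ p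

  ∣-refl : ∀ {p} → p ∣ p
  ∣-refl {p} = 1ₚ , ≈-sym (*ₚ-identityˡ p)

  ∣-congʳ : ∀ {p q r} → q ≈ r → p ∣ q → p ∣ r
  ∣-congʳ e (c , h) = c , ≈-trans (≈-sym e) h

  ∣-congˡ : ∀ {p q r} → p ≈ q → p ∣ r → q ∣ r
  ∣-congˡ e (c , h) = c , ≈-trans h (*ₚ-congˡ c e)

  ∣-trans : ∀ {p q r} → p ∣ q → q ∣ r → p ∣ r
  ∣-trans {p} (c , h) (d , k) = d *ₚ c , ≈-trans k (≈-trans (*ₚ-congˡ d h) (≈-sym (*ₚ-assoc d c p)))

  ∣-*ˡ : ∀ {p q} r → p ∣ q → p ∣ r *ₚ q
  ∣-*ˡ r = λ h → ∣-trans h (r , ≈-refl)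

  ∣-*ʳ : ∀ {p q} r → p ∣ q → p ∣ q *ₚ r
  ∣-*ʳ {p} {q} r h = ∣-congʳ (*ₚ-comm r q) (∣-*ˡ r h)

  ∣-+ : ∀ {p q r} → p ∣ q → p ∣ r → p ∣ q +ₚ r
  ∣-+ {p} (c , h) (d , k) = c +ₚ d , ≈-trans (+ₚ-cong h k) (≈-sym (*ₚ-distribʳ p c d))

  ∣0 : ∀ {p} → p ∣ []
  ∣0 = [] , ≈-refl

  +≈0⇒≈ : ∀ {p q} → p +ₚ q ≈ [] → p ≈ q
  +≈0⇒≈ {p} {q} h = ≈-trans (≈-trans (solve 2 (λ p q → p := (p :+ q) :+ q) ≈-refl p q) (+ₚ-cong h ≈-refl)) ≈-refl

  ∣-degree : ∀ {p q d e} → HasDegree p d → HasDegree q e → p ∣ q → d ≤ e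
  ∣-degree {p} {q} {d} {e} hp hq (c , h) with zeroOrDegree c
  ... | inj₁ c≈0 = ⊥-elim (degree≉0 hq (≈-trans h (*ₚ-cong c≈0 ≈-refl)))
  ... | inj₂ (f , hc) = subst (d ≤_) (degree-unique (*ₚ-degree {c} hc hp) (degree-cong h hq)) (m≤n+m d f)

  ∣low⇒0 : ∀ {e} (v r : Vec Bool e) → monic v ∣ low r → r ≡ 0#
  ∣low⇒0 {e} v r h with zeroOrDegree (low r)
  ... | inj₁ z = low-injective r 0# (≈-trans z (≈-sym (low-0 e)))
  ... | inj₂ (d , hd) = ⊥-elim (<⇒≱ (low-degree r hd) (∣-degree (monic-degree v) hd h))

  _≟ᵥ_ : ∀ {n} (v w : Vec Bool n) → Dec (v ≡ w)
  _≟ᵥ_ = ≡-dec Data.Bool._≟_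

  rem-∣ : ∀ {e} (v : Vec Bool e) p → monic v ∣ p +ₚ low (rem v p)
  rem-∣ v p = proj₁ (divMod v p) , ≈-trans (+ₚ-cong (divMod-spec v p) ≈-refl)
    (solve 2 (λ x y → (x :+ y) :+ y := x) ≈-refl (proj₁ (divMod v p) *ₚ monic v) (low (rem v p)))

  rem≡0⇒∣ : ∀ {e} (v : Vec Bool e) p → rem v p ≡ 0# → monic v ∣ p
  rem≡0⇒∣ {e} v p h = ∣-congʳ (≈-trans (+ₚ-cong (≈-refl {p}) (≈-trans (≈-reflexive (cong low h)) (low-0 e))) (≈-reflexive (+ₚ-identityʳ p))) (rem-∣ v p)

  ∣⇒rem≡0 : ∀ {e} (v : Vec Bool e) p → monic v ∣ p → rem v p ≡ 0#
  ∣⇒rem≡0 v p h = ∣low⇒0 v (rem v p) (∣-congʳ (solve 2 (λ x y → x :+ (x :+ y) := y) ≈-refl p (low (rem v p))) (∣-+ h (rem-∣ v p)))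

  _∣?_ : ∀ {e} (v : Vec Bool e) p → Dec (monic v ∣ p)
  v ∣? p = map′ (rem≡0⇒∣ v p) (∣⇒rem≡0 v p) (rem v p ≟ᵥ 0#)

  anyVec? : ∀ {n} {P : Vec Bool n → Set} → (∀ v → Dec (P v)) → Dec (∃ P)
  anyVec? {zero} P? = map′ (λ h → [] , h) (λ { ([] , h) → h }) (P? [])
  anyVec? {suc n} P? = map′
    (λ { (inj₁ (v , h)) → false ∷ v , h ; (inj₂ (v , h)) → true ∷ v , h })
    (λ { (false ∷ v , h) → inj₁ (v , h) ; (true ∷ v , h) → inj₂ (v , h) })
    (anyVec? (λ v → P? (false ∷ v)) ⊎-dec anyVec? (λ v → P? (true ∷ v)))

  -- Over 𝔽₂ every nonzero polynomial is monic, so the encoded divisors are all the divisors.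
  record Irreducible {e} (v : Vec Bool e) : Set where
    field
      nonconstant : 1 ≤ e
      noDivisor : ∀ {d} (u : Vec Bool d) → 1 ≤ d → d < e → ¬ (monic u ∣ monic v)
  open Irreducible

  irreducibleFactor : ∀ {e} (v : Vec Bool e) → 1 ≤ e → ∃[ d ] ∃[ u ] (Irreducible {d} u × monic u ∣ monic v)
  irreducibleFactor {e} v l = go v l (<-wellFounded e)
    where
    go : ∀ {e} (v : Vec Bool e) → 1 ≤ e → Acc _<_ e → ∃[ d ] ∃[ u ] (Irreducible {d} u × monic u ∣ monic v)
    go {e} v l (acc rs) with anyUpTo? (λ d → (1 ≤? d) ×-dec anyVec? (λ u → u ∣? monic v)) e
    ... | no none = e , v , record { nonconstant = l ; noDivisor = λ u 1≤d d<e h → none (_ , d<e , 1≤d , u , h) } , ∣-refl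
    ... | yes (d , d<e , 1≤d , u , h) with go u 1≤d (rs d<e)
    ... | d' , u' , irr , h' = d' , u' , irr , ∣-trans h' h

  -- Euclid's algorithm, run on a single irreducible polynomial: the remainder of v
  -- by u is again prime to v, and of smaller degree.
  inverseMod : ∀ {e} {v : Vec Bool e} → Irreducible v → ∀ {d} (u : Vec Bool d) → d < e →
    ∃[ s ] (monic v ∣ s *ₚ monic u +ₚ 1ₚ)
  inverseMod {e} {v} irr {d} u d<e = go u d<e (<-wellFounded d)
    where
    go : ∀ {d} (u : Vec Bool d) → d < e → Acc _<_ d → ∃[ s ] (monic v ∣ s *ₚ monic u +ₚ 1ₚ)
    go [] _ _ = 1ₚ , ∣-congʳ {q = []} (≈-sym (mk≈ λ { zero → refl ; (suc zero) → refl ; (suc (suc i)) → refl })) ∣0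
    go {suc d} u d<e (acc rs) with divMod u (monic v) | divMod-spec u (monic v)
    ... | q , r | spec with zeroOrDegree (low r)
    ... | inj₁ z = ⊥-elim (noDivisor irr u (s≤s z≤n) d<e (q , ≈-trans spec (≈-trans (+ₚ-cong ≈-refl z) (≈-reflexive (+ₚ-identityʳ _)))))
    ... | inj₂ (d' , hd) with go (firstCoefs d' (low r)) (<-trans (low-degree r hd) d<e) (rs (low-degree r hd))
    ... | s , h = s *ₚ q , ∣-congʳ eq (∣-+ h (∣-*ˡ s ∣-refl))
      where
      eq : s *ₚ monic (firstCoefs d' (low r)) +ₚ 1ₚ +ₚ s *ₚ monic v ≈ (s *ₚ q) *ₚ monic u +ₚ 1ₚ
      eq = ≈-trans (+ₚ-cong (+ₚ-cong (*ₚ-congˡ s (≈-sym (toMonic (low r) hd))) (≈-refl {1ₚ})) (*ₚ-congˡ s spec))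
        (solve 4 (λ s q u r → s :* r :+ con true :+ s :* (q :* u :+ r) := (s :* q) :* u :+ con true) ≈-refl s q (monic u) (low r))

  inverse : ∀ {e} {v : Vec Bool e} → Irreducible v → ∀ p → ¬ (monic v ∣ p) → ∃[ s ] (monic v ∣ s *ₚ p +ₚ 1ₚ)
  inverse {e} {v} irr p v∤p with zeroOrDegree (low (rem v p))
  ... | inj₁ z = ⊥-elim (v∤p (rem≡0⇒∣ v p (low-injective _ _ (≈-trans z (≈-sym (low-0 e))))))
  ... | inj₂ (d , hd) with inverseMod irr (firstCoefs d (low (rem v p))) (low-degree (rem v p) hd)
  ... | s , h = s , ∣-congʳ eq (∣-+ h (∣-*ˡ s (rem-∣ v p)))
    where
    eq : s *ₚ monic (firstCoefs d (low (rem v p))) +ₚ 1ₚ +ₚ s *ₚ (p +ₚ low (rem v p)) ≈ s *ₚ p +ₚ 1ₚ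
    eq = ≈-trans (+ₚ-cong (+ₚ-cong (*ₚ-congˡ s (≈-sym (toMonic (low (rem v p)) hd))) (≈-refl {1ₚ})) ≈-refl)
      (solve 3 (λ s r p → s :* r :+ con true :+ s :* (p :+ r) := s :* p :+ con true) ≈-refl s (low (rem v p)) p)

  euclid : ∀ {e} {v : Vec Bool e} → Irreducible v → ∀ p q → monic v ∣ p *ₚ q → ¬ (monic v ∣ p) → monic v ∣ q
  euclid irr p q h v∤p with inverse irr p v∤p
  ... | s , k = ∣-congʳ (solve 3 (λ s p q → s :* (p :* q) :+ (s :* p :+ con true) :* q := q) ≈-refl s p q)
    (∣-+ (∣-*ˡ s h) (∣-*ʳ q k))

  -- Derivatives and squarefree polynomials

  deriv : Poly → Poly
  deriv [] = []
  -- The product rule for a + X p.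
  deriv (a ∷ p) = p +ₚ (false ∷ deriv p)

  deriv-+ : ∀ p q → deriv (p +ₚ q) ≈ deriv p +ₚ deriv q
  deriv-+ [] q = ≈-refl
  deriv-+ (a ∷ p) [] = ≈-reflexive (sym (+ₚ-identityʳ _))
  deriv-+ (a ∷ p) (b ∷ q) = ≈-trans (+ₚ-cong (≈-refl {p +ₚ q}) (∷-cong (deriv-+ p q)))
    (+ₚ-interchange p q (false ∷ deriv p) (false ∷ deriv q))

  deriv-0 : ∀ {p} → p ≈ [] → deriv p ≈ []
  deriv-0 {[]} e = ≈-refl
  deriv-0 {a ∷ p} e = ≈-trans (+ₚ-cong p≈0 (∷-cong (deriv-0 p≈0))) false∷[]
    where
    p≈0 : p ≈ []
    p≈0 = mk≈ λ i → at e (suc i)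

  deriv-cong : ∀ {p q} → p ≈ q → deriv p ≈ deriv q
  deriv-cong {p} {q} e = +≈0⇒≈ (≈-trans (≈-sym (deriv-+ p q)) (deriv-0 (≈-trans (+ₚ-cong e (≈-refl {q})) (+ₚ-self q))))

  deriv-· : ∀ a p → deriv (a ·ₚ p) ≡ a ·ₚ deriv p
  deriv-· true p = refl
  deriv-· false p = refl

  deriv-* : ∀ p q → deriv (p *ₚ q) ≈ deriv p *ₚ q +ₚ p *ₚ deriv q
  deriv-* [] q = ≈-refl
  deriv-* (a ∷ p) q = begin
    deriv (a ·ₚ q +ₚ (false ∷ p *ₚ q))
      ≈⟨ deriv-+ (a ·ₚ q) (false ∷ p *ₚ q) ⟩
    deriv (a ·ₚ q) +ₚ (p *ₚ q +ₚ (false ∷ deriv (p *ₚ q)))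
      ≈⟨ +ₚ-cong (≈-reflexive (deriv-· a q)) (+ₚ-cong (≈-refl {p *ₚ q}) (∷-cong (deriv-* p q))) ⟩
    a ·ₚ deriv q +ₚ (p *ₚ q +ₚ ((false ∷ deriv p *ₚ q) +ₚ (false ∷ p *ₚ deriv q)))
      ≈⟨ solve 4 (λ u v w x → u :+ (v :+ (w :+ x)) := (v :+ w) :+ (u :+ x)) ≈-refl
           (a ·ₚ deriv q) (p *ₚ q) (false ∷ deriv p *ₚ q) (false ∷ p *ₚ deriv q) ⟩
    (p *ₚ q +ₚ (false ∷ deriv p *ₚ q)) +ₚ (a ·ₚ deriv q +ₚ (false ∷ p *ₚ deriv q))
      ≈⟨ +ₚ-cong (*ₚ-distribʳ q p (false ∷ deriv p)) (≈-refl {(a ∷ p) *ₚ deriv q}) ⟨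
    (p +ₚ (false ∷ deriv p)) *ₚ q +ₚ (a ∷ p) *ₚ deriv q ∎
    where open ≈-Reasoning

  Squarefree : Poly → Set
  Squarefree p = ∀ {e} (v : Vec Bool e) → Irreducible v → ¬ (monic v *ₚ monic v ∣ p)

  irreducible∤1 : ∀ {e} {v : Vec Bool e} → Irreducible v → ¬ (monic v ∣ 1ₚ)
  irreducible∤1 {v = v} irr h = <⇒≱ (nonconstant irr)
    (∣-degree (monic-degree v) (degree refl λ { (suc i) _ → refl }) h)

  -- A repeated factor would divide the derivative, hence 1.
  deriv-1⇒squarefree : ∀ p → deriv p ≈ 1ₚ → Squarefree p
  deriv-1⇒squarefree p h v irr (c , e) = irreducible∤1 irr (deriv c *ₚ m , ≈-trans (≈-sym h) (begin
    deriv p                                             ≈⟨ deriv-cong e ⟩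
    deriv (c *ₚ (m *ₚ m))                               ≈⟨ deriv-* c (m *ₚ m) ⟩
    deriv c *ₚ (m *ₚ m) +ₚ c *ₚ deriv (m *ₚ m)          ≈⟨ +ₚ-cong ≈-refl (*ₚ-congˡ c (deriv-* m m)) ⟩
    deriv c *ₚ (m *ₚ m) +ₚ c *ₚ (deriv m *ₚ m +ₚ m *ₚ deriv m)
      ≈⟨ solve 4 (λ c c′ m m′ → c′ :* (m :* m) :+ c :* (m′ :* m :+ m :* m′) := (c′ :* m) :* m) ≈-refl c (deriv c) m (deriv m) ⟩
    (deriv c *ₚ m) *ₚ m                                 ∎))
    where
    open ≈-Reasoning
    m = monic v

  infixr 8 _^2^_
  -- The power with exponent 2^i.
  _^2^_ : Poly → ℕ → Poly
  p ^2^ zero = p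
  p ^2^ suc i = p ^2^ i *ₚ p ^2^ i

  X^2^-degree : ∀ i → HasDegree (X ^2^ i) (2 ^ i)
  X^2^-degree zero = degree refl λ { (suc (suc i)) _ → refl ; (suc zero) (s≤s ()) }
  X^2^-degree (suc i) = subst (HasDegree (X ^2^ suc i)) (cong (2 ^ i +_) (sym (+-identityʳ _)))
    (*ₚ-degree (X^2^-degree i) (X^2^-degree i))

  -- The index is shifted by one because X + X^(2^0) = 0; `X+X^2^ j` belongs to the field with
  -- 2^(j+1) elements.
  X+X^2^ : ℕ → Poly
  X+X^2^ i = X +ₚ X ^2^ suc i

  X+X^2^-degree : ∀ i → HasDegree (X+X^2^ i) (2 ^ suc i)
  X+X^2^-degree i = +ₚ-degree {q = X} (X^2^-degree (suc i)) λ j l → small j (≤-trans (*-monoʳ-≤ 2 (m^n>0 2 i)) l)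
    where
    small : ∀ j → 2 ≤ j → coef X j ≡ false
    small (suc (suc j)) _ = refl
    small (suc zero) (s≤s ())

  X+X^2^-squarefree : ∀ i → Squarefree (X+X^2^ i)
  X+X^2^-squarefree i = deriv-1⇒squarefree (X+X^2^ i) (≈-trans (deriv-+ X (X ^2^ suc i))
    (≈-trans (+ₚ-cong {deriv X} {1ₚ} (mk≈ λ { zero → refl ; (suc zero) → refl ; (suc (suc i)) → refl })
      (≈-trans (deriv-* (X ^2^ i) (X ^2^ i)) (solve 2 (λ p p′ → p′ :* p :+ p :* p′ := con false) ≈-refl (X ^2^ i) (deriv (X ^2^ i)))))
      (≈-reflexive (+ₚ-identityʳ 1ₚ))))

  irreducible∣irreducible : ∀ {d e} {u : Vec Bool d} {v : Vec Bool e} → Irreducible u → Irreducible v →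
    monic u ∣ monic v → monic v ≈ monic u
  irreducible∣irreducible {d} {e} {u} {v} iu iv (c , h) with m≤n⇒m<n∨m≡n (∣-degree (monic-degree u) (monic-degree v) (c , h))
  ... | inj₁ d<e = ⊥-elim (noDivisor iv u (nonconstant iu) d<e (c , h))
  ... | inj₂ refl with zeroOrDegree c
  ... | inj₁ z = ⊥-elim (degree≉0 (monic-degree v) (≈-trans h (*ₚ-cong z ≈-refl)))
  ... | inj₂ (f , hc) with +-cancelʳ-≡ d f 0 (degree-unique (*ₚ-degree hc (monic-degree u)) (degree-cong h (monic-degree v)))
  ... | refl = ≈-trans h (≈-trans (*ₚ-cong (toMonic c hc) ≈-refl) (*ₚ-identityˡ _))

  -- Irreducible factors that tell two polynomials apart

  Separates : Poly → Poly → Set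
  Separates f g = (f ∣ g) ⊎ ∃[ e ] ∃[ v ] (Irreducible {e} v × monic v ∣ f × ¬ (monic v ∣ g))

  -- Cancelling a common irreducible factor `v` keeps a witness `u`: if `u` divided `g` but not
  -- `g′`, it would divide `v` and so equal it, and then the square of `v` would divide `f`.
  separates-*ˡ : ∀ {f g c g′ e} {v : Vec Bool e} → Irreducible v → Squarefree f →
    f ≈ c *ₚ monic v → g ≈ g′ *ₚ monic v → Separates c g′ → Separates f g
  separates-*ˡ {c = c} {v = v} irr sf f≈cv g≈g′v (inj₁ (z , g′≈zc)) = inj₁ (z ,
    ≈-trans g≈g′v (≈-trans (*ₚ-cong g′≈zc ≈-refl) (≈-trans (*ₚ-assoc z c (monic v)) (*ₚ-congˡ z (≈-sym f≈cv)))))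
  separates-*ˡ {f} {g} {c} {g′} {v = v} irr sf f≈cv g≈g′v (inj₂ (d , u , iu , u∣c , u∤g′)) =
    inj₂ (d , u , iu , ∣-congʳ (≈-sym f≈cv) (∣-*ʳ (monic v) u∣c) , u∤g)
    where
    v²∣f : monic v ∣ c → monic v *ₚ monic v ∣ f
    v²∣f (y , h) = y , ≈-trans f≈cv (≈-trans (*ₚ-cong h ≈-refl) (*ₚ-assoc y (monic v) (monic v)))
    u∤g : ¬ (monic u ∣ g)
    u∤g u∣g = sf v irr (v²∣f (∣-congˡ (≈-sym (irreducible∣irreducible iu irr u∣v)) u∣c))
      where
      u∣v : monic u ∣ monic v
      u∣v = euclid iu g′ (monic v) (∣-congʳ g≈g′v u∣g) u∤g′

  squarefree-∣ : ∀ {p q} → p ∣ q → Squarefree q → Squarefree p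
  squarefree-∣ p∣q sf v irr h = sf v irr (∣-trans h p∣q)

  cofactor-degree : ∀ {f c e D} {v : Vec Bool e} → 1 ≤ e → HasDegree f D → f ≈ c *ₚ monic v →
    ∃[ D′ ] (HasDegree c D′ × D′ < D)
  cofactor-degree {f} {c} {e} {D} {v} 1≤e hf f≈cv with zeroOrDegree c
  ... | inj₁ z = ⊥-elim (degree≉0 hf (≈-trans f≈cv (*ₚ-cong z ≈-refl)))
  ... | inj₂ (D′ , hc) = D′ , hc , subst (D′ <_) (degree-unique (*ₚ-degree hc (monic-degree v)) (degree-cong f≈cv hf)) (m<m+n D′ 1≤e)

  -- Common irreducible factors are cancelled from `f` and `g` until one divides only the first, or
  -- until `f` is used up and therefore divides `g`.
  separatingFactor : ∀ f {D} → HasDegree f D → Squarefree f → ∀ g → Separates f g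
  separatingFactor f {D} = go f (<-wellFounded D)
    where
    go : ∀ f {D} → Acc _<_ D → HasDegree f D → Squarefree f → ∀ g → Separates f g
    go f {zero} _ hf _ g = inj₁ (g , ≈-trans (≈-sym (*ₚ-identityˡ g)) (≈-trans (*ₚ-comm 1ₚ g) (*ₚ-congˡ g (≈-sym (toMonic f hf)))))
    go f {suc D} (acc rs) hf sf g = split (irreducibleFactor (firstCoefs (suc D) f) (s≤s z≤n))
      where
      split : ∃[ e ] ∃[ v ] (Irreducible {e} v × monic v ∣ monic (firstCoefs (suc D) f)) → Separates f g
      split (e , v , irr , c , h) = divide (v ∣? g) (cofactor-degree {c = c} {v = v} (nonconstant irr) hf f≈cv)
        where
        f≈cv : f ≈ c *ₚ monic v
        f≈cv = ≈-trans (toMonic f hf) h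
        divide : Dec (monic v ∣ g) → ∃[ D′ ] (HasDegree c D′ × D′ < suc D) → Separates f g
        divide (no v∤g) _ = inj₂ (e , v , irr , (c , f≈cv) , v∤g)
        divide (yes (g′ , g≈g′v)) (D′ , hc , D′<D) =
          separates-*ˡ irr sf f≈cv g≈g′v (go c (rs D′<D) hc (squarefree-∣ (monic v , ≈-trans f≈cv (*ₚ-comm c (monic v))) sf) g′)

  ∏X+X^2^ : ℕ → Poly
  ∏X+X^2^ zero = 1ₚ
  ∏X+X^2^ (suc j) = ∏X+X^2^ j *ₚ X+X^2^ j

  ∏X+X^2^-degree : ∀ j → ∃[ D ] (HasDegree (∏X+X^2^ j) D × D + 2 ≡ 2 ^ suc j)
  ∏X+X^2^-degree zero = 0 , degree refl (λ { (suc i) _ → refl }) , refl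
  ∏X+X^2^-degree (suc j) with ∏X+X^2^-degree j
  ... | D , h , e = D + 2 ^ suc j , *ₚ-degree h (X+X^2^-degree j) ,
    trans (+-assoc D _ 2) (trans (cong (D +_) (+-comm _ 2)) (trans (sym (+-assoc D 2 _)) (cong₂ _+_ e (sym (+-identityʳ _)))))

  ∣∏X+X^2^ : ∀ {p} j {i} → i < j → p ∣ X+X^2^ i → p ∣ ∏X+X^2^ j
  ∣∏X+X^2^ (suc j) {i} (s≤s l) h with m≤n⇒m<n∨m≡n l
  ... | inj₁ i<j = ∣-*ʳ (X+X^2^ j) (∣∏X+X^2^ j i<j h)
  ... | inj₂ refl = ∣-*ˡ (∏X+X^2^ j) h

  -- The degrees 2 + 4 + ⋯ + 2^j of the smaller polynomials add up to less than 2^(j+1).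
  primitiveFactor : ∀ j → ∃[ e ] ∃[ v ] (Irreducible {e} v × monic v ∣ X+X^2^ j × (∀ i → i < j → ¬ (monic v ∣ X+X^2^ i)))
  primitiveFactor j with separatingFactor (X+X^2^ j) (X+X^2^-degree j) (X+X^2^-squarefree j) (∏X+X^2^ j) | ∏X+X^2^-degree j
  ... | inj₁ f∣g | D , h , e = ⊥-elim (<⇒≱ (subst (D <_) e (m<m+n D (s≤s z≤n))) (∣-degree (X+X^2^-degree j) h f∣g))
  ... | inj₂ (e , v , irr , v∣f , v∤g) | _ = e , v , irr , v∣f , λ i i<j k → v∤g (∣∏X+X^2^ j i<j k)

-- Finite fields of order 2^k

⊕-assoc : ∀ {n} (a b c : Z2^ n) → (a ⊕ b) ⊕ c ≡ a ⊕ (b ⊕ c)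
⊕-assoc = zipWith-assoc xor-assoc

⊕-comm : ∀ {n} (a b : Z2^ n) → a ⊕ b ≡ b ⊕ a
⊕-comm = zipWith-comm xor-comm

⊕-identityˡ : ∀ {n} (a : Z2^ n) → 0# ⊕ a ≡ a
⊕-identityˡ = zipWith-identityˡ λ _ → refl

⊕-identityʳ : ∀ {n} (a : Z2^ n) → a ⊕ 0# ≡ a
⊕-identityʳ = zipWith-identityʳ xor-identityʳ

⊕-self : ∀ {n} (a : Z2^ n) → a ⊕ a ≡ 0#
⊕-self [] = refl
⊕-self (b ∷ a) = cong₂ _∷_ (xor-same b) (⊕-self a)

⊕-cancelʳ : ∀ {n} (a b : Z2^ n) → (a ⊕ b) ⊕ b ≡ a
⊕-cancelʳ a b = trans (⊕-assoc a b b) (trans (cong (a ⊕_) (⊕-self b)) (⊕-identityʳ a))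

⊕≡0⇒≡ : ∀ {n} {a b : Z2^ n} → a ⊕ b ≡ 0# → a ≡ b
⊕≡0⇒≡ {a = a} {b} h = trans (sym (⊕-cancelʳ a b)) (trans (cong (_⊕ b) h) (⊕-identityˡ b))

allVecs : ∀ n → List (Z2^ n)
allVecs zero = [] ∷ []
allVecs (suc n) = List.map (false ∷_) (allVecs n) ++ List.map (true ∷_) (allVecs n)

∈-allVecs : ∀ {n} (v : Z2^ n) → v ∈ allVecs n
∈-allVecs [] = here refl
∈-allVecs (false ∷ v) = ∈-++⁺ˡ (∈-map⁺ (false ∷_) (∈-allVecs v))
∈-allVecs {suc n} (true ∷ v) = ∈-++⁺ʳ (List.map (false ∷_) (allVecs n)) (∈-map⁺ (true ∷_) (∈-allVecs v))

allVecs-unique : ∀ n → Unique (allVecs n)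
allVecs-unique zero = [] ∷ []
allVecs-unique (suc n) = Uniqueₚ.++⁺ (Uniqueₚ.map⁺ ∷-injectiveʳ (allVecs-unique n)) (Uniqueₚ.map⁺ ∷-injectiveʳ (allVecs-unique n))
  λ { (p , q) → disjoint p q }
  where
  disjoint : ∀ {v} → v ∈ List.map (false ∷_) (allVecs n) → v ∈ List.map (true ∷_) (allVecs n) → ⊥
  disjoint p q with ∈-map⁻ (false ∷_) p | ∈-map⁻ (true ∷_) q
  ... | _ , _ , refl | _ , _ , ()

length-allVecs : ∀ n → length (allVecs n) ≡ 2 ^ n
length-allVecs zero = refl
length-allVecs (suc n) = trans (length-++ (List.map (false ∷_) (allVecs n)))
  (cong₂ _+_ (trans (length-map _ (allVecs n)) (length-allVecs n))
             (trans (length-map _ (allVecs n)) (trans (length-allVecs n) (sym (+-identityʳ _)))))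

-- Addition is fixed to be `⊕`, so sums in ℤ₂^m are sums of field elements, coordinate by
-- coordinate.
record BinaryField (k : ℕ) : Set where
  infixl 25 _·_
  field
    _·_ : Z2^ k → Z2^ k → Z2^ k
    1# : Z2^ k
    ·-assoc : ∀ a b c → (a · b) · c ≡ a · (b · c)
    ·-comm : ∀ a b → a · b ≡ b · a
    ·-identityˡ : ∀ a → 1# · a ≡ a
    ·-distribʳ : ∀ a b c → (b ⊕ c) · a ≡ (b · a) ⊕ (c · a)
    ·-inverse : ∀ a → a ≢ 0# → ∃[ b ] b · a ≡ 1#
    1≢0 : 1# ≢ 0#

  zeroˡ : ∀ a → 0# · a ≡ 0#
  zeroˡ a = begin
    0# · a                              ≡⟨ ⊕-cancelʳ (0# · a) (0# · a) ⟨
    ((0# · a) ⊕ (0# · a)) ⊕ (0# · a)    ≡⟨ cong (_⊕ 0# · a) (·-distribʳ a 0# 0#) ⟨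
    (0# ⊕ 0#) · a ⊕ 0# · a              ≡⟨ cong (λ z → z · a ⊕ 0# · a) (⊕-identityˡ 0#) ⟩
    0# · a ⊕ 0# · a                     ≡⟨ ⊕-self _ ⟩
    0#                                  ∎
    where open ≡-Reasoning

  semiring : CommutativeSemiring 0ℓ 0ℓ
  semiring = record
    { Carrier = Z2^ k ; _≈_ = _≡_ ; _+_ = _⊕_ ; _*_ = _·_ ; 0# = 0# ; 1# = 1#
    ; isCommutativeSemiring = record
      { isSemiring = record
        { isSemiringWithoutAnnihilatingZero = record
          { +-isCommutativeMonoid = record
            { isMonoid = record
              { isSemigroup = record
                { isMagma = record { isEquivalence = isEquivalence ; ∙-cong = cong₂ _⊕_ }
                ; assoc = ⊕-assoc }
              ; identity = ⊕-identityˡ , ⊕-identityʳ }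
            ; comm = ⊕-comm }
          ; *-cong = cong₂ _·_
          ; *-assoc = ·-assoc
          ; *-identity = ·-identityˡ , λ a → trans (·-comm a 1#) (·-identityˡ a)
          ; distrib = (λ a b c → trans (·-comm a (b ⊕ c)) (trans (·-distribʳ a b c) (cong₂ _⊕_ (·-comm b a) (·-comm c a)))) , ·-distribʳ }
        ; zero = zeroˡ , λ a → trans (·-comm a 0#) (zeroˡ a) }
      ; *-comm = ·-comm } }

-- The Frobenius map and roots of polynomials

module FieldTheory {k} (F : BinaryField k) where
  open BinaryField F
  open Char2Solver semiring (⊕-self 1#) public

  zeroʳ : ∀ a → a · 0# ≡ 0#
  zeroʳ a = trans (·-comm a 0#) (zeroˡ a)

  ·-cancelˡ : ∀ a {b c} → a ≢ 0# → a · b ≡ a · c → b ≡ c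
  ·-cancelˡ a {b} {c} a≢0 h with ·-inverse a a≢0
  ... | a⁻¹ , e = trans (sym (undo b)) (trans (cong (a⁻¹ ·_) h) (undo c))
    where
    undo : ∀ b → a⁻¹ · (a · b) ≡ b
    undo b = trans (sym (·-assoc a⁻¹ a b)) (trans (cong (_· b) e) (·-identityˡ b))

  ·≡0 : ∀ {a b} → a · b ≡ 0# → a ≢ 0# → b ≡ 0#
  ·≡0 {a} h a≢0 = ·-cancelˡ a a≢0 (trans h (sym (zeroʳ a)))

  ·≢0 : ∀ {a b} → a ≢ 0# → b ≢ 0# → a · b ≢ 0#
  ·≢0 a≢0 b≢0 h = b≢0 (·≡0 h a≢0)

  -- The iterated Frobenius map, `a` to the power 2^i.
  sq^ : Z2^ k → ℕ → Z2^ k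
  sq^ a zero = a
  sq^ a (suc i) = sq^ a i · sq^ a i

  sq^-⊕ : ∀ a b i → sq^ (a ⊕ b) i ≡ sq^ a i ⊕ sq^ b i
  sq^-⊕ a b zero = refl
  sq^-⊕ a b (suc i) = trans (cong₂ _·_ (sq^-⊕ a b i) (sq^-⊕ a b i))
    (solve 2 (λ a b → (a :+ b) :* (a :+ b) := a :* a :+ b :* b) refl (sq^ a i) (sq^ b i))

  sq^-· : ∀ a b i → sq^ (a · b) i ≡ sq^ a i · sq^ b i
  sq^-· a b zero = refl
  sq^-· a b (suc i) = trans (cong₂ _·_ (sq^-· a b i) (sq^-· a b i))
    (solve 2 (λ a b → (a :* b) :* (a :* b) := (a :* a) :* (b :* b)) refl (sq^ a i) (sq^ b i))

  sq^-+ : ∀ a i j → sq^ a (i + j) ≡ sq^ (sq^ a j) i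
  sq^-+ a zero j = refl
  sq^-+ a (suc i) j = cong₂ _·_ (sq^-+ a i j) (sq^-+ a i j)

  sq-injective : ∀ {a b} → a · a ≡ b · b → a ≡ b
  sq-injective {a} {b} h with (a ⊕ b) ≟ᵥ 0#
  ... | yes e = ⊕≡0⇒≡ e
  ... | no a⊕b≢0 = ⊥-elim (·≢0 a⊕b≢0 a⊕b≢0 (trans (sq^-⊕ a b 1) (trans (cong (_⊕ (b · b)) h) (⊕-self _))))

  sq^-injective : ∀ {a b} i → sq^ a i ≡ sq^ b i → a ≡ b
  sq^-injective zero h = h
  sq^-injective (suc i) h = sq^-injective i (sq-injective h)

  bit : Bool → Z2^ k
  bit b = if b then 1# else 0#

  sq^-bit : ∀ b i → sq^ (bit b) i ≡ bit b
  sq^-bit b zero = refl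
  sq^-bit false (suc i) = trans (cong₂ _·_ (sq^-bit false i) (sq^-bit false i)) (zeroˡ 0#)
  sq^-bit true (suc i) = trans (cong₂ _·_ (sq^-bit true i) (sq^-bit true i)) (·-identityˡ 1#)

  evalBits : Poly → Z2^ k → Z2^ k
  evalBits [] a = 0#
  evalBits (b ∷ p) a = bit b ⊕ (a · evalBits p a)

  -- Frobenius fixes the coefficients. So it permutes roots of a polynomial over 𝔽₂, and whatever
  -- power of it fixes `a` fixes every polynomial in `a`.
  sq^-evalBits : ∀ p a i → sq^ (evalBits p a) i ≡ evalBits p (sq^ a i)
  sq^-evalBits [] a i = sq^-bit false i
  sq^-evalBits (b ∷ p) a i = trans (sq^-⊕ (bit b) _ i)
    (cong₂ _⊕_ (sq^-bit b i) (trans (sq^-· a _ i) (cong (sq^ a i ·_) (sq^-evalBits p a i))))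

  -- the leading coefficient 1 is not stored
  evalMonic : List (Z2^ k) → Z2^ k → Z2^ k
  evalMonic [] a = 1#
  evalMonic (c ∷ cs) a = c ⊕ (a · evalMonic cs a)

  -- Synthetic division of the monic `c ∷ cs` by X + r: the coefficients of the quotient are the
  -- values at `r` of the tails in Horner's scheme.
  deflate : Z2^ k → Z2^ k → List (Z2^ k) → List (Z2^ k)
  deflate r c [] = []
  deflate r c (d ∷ cs) = evalMonic (d ∷ cs) r ∷ deflate r d cs

  length-deflate : ∀ r c cs → length (deflate r c cs) ≡ length cs
  length-deflate r c [] = refl
  length-deflate r c (d ∷ cs) = cong suc (length-deflate r d cs)

  deflate-spec : ∀ r c cs a → evalMonic (c ∷ cs) a ≡ ((a ⊕ r) · evalMonic (deflate r c cs) a) ⊕ evalMonic (c ∷ cs) r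
  deflate-spec r c [] a = solve 3 (λ r c a → c :+ a :* con true := (a :+ r) :* con true :+ (c :+ r :* con true)) refl r c a
  deflate-spec r c (d ∷ cs) a = trans (cong (λ z → c ⊕ (a · z)) (deflate-spec r d cs a))
    (solve 5 (λ r c a h g → c :+ a :* ((a :+ r) :* h :+ g) := (a :+ r) :* (g :+ a :* h) :+ (c :+ r :* g)) refl
      r c a (evalMonic (deflate r d cs) a) (evalMonic (d ∷ cs) r))

  roots≤degree : ∀ cs {xs} → Unique xs → All (λ x → evalMonic cs x ≡ 0#) xs → length xs ≤ length cs
  roots≤degree cs [] [] = z≤n
  roots≤degree [] (_ ∷ _) (h ∷ _) = ⊥-elim (1≢0 h)
  roots≤degree (c ∷ cs) {x ∷ xs} (x∉xs ∷ u) (hx ∷ hxs) = s≤s (subst (length xs ≤_) (length-deflate x c cs)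
    (roots≤degree (deflate x c cs) u (All.zipWith (λ { (x≢y , hy) → deflated x≢y hy }) (x∉xs , hxs))))
    where
    deflated : ∀ {y} → x ≢ y → evalMonic (c ∷ cs) y ≡ 0# → evalMonic (deflate x c cs) y ≡ 0#
    deflated {y} x≢y hy = ·≡0 (trans (sym (⊕-identityʳ _)) (trans (sym (trans (deflate-spec x c cs y) (cong (((y ⊕ x) · evalMonic (deflate x c cs) y) ⊕_) hx))) hy))
      (λ e → x≢y (sym (⊕≡0⇒≡ e)))

  pow : Z2^ k → ℕ → Z2^ k
  pow a zero = 1#
  pow a (suc n) = a · pow a n

  pow-+ : ∀ a m n → pow a (m + n) ≡ pow a m · pow a n
  pow-+ a zero n = sym (·-identityˡ _)
  pow-+ a (suc m) n = trans (cong (a ·_) (pow-+ a m n)) (sym (·-assoc a _ _))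

  sq^≡pow : ∀ a i → sq^ a i ≡ pow a (2 ^ i)
  sq^≡pow a zero = solve 1 (λ a → a := a :* con true) refl a
  sq^≡pow a (suc i) = trans (cong₂ _·_ (sq^≡pow a i) (sq^≡pow a i)) (trans (sym (pow-+ a (2 ^ i) (2 ^ i)))
    (cong (λ z → pow a (2 ^ i + z)) (sym (+-identityʳ (2 ^ i)))))

  evalMonic-replicate : ∀ n a → evalMonic (List.replicate n 0#) a ≡ pow a n
  evalMonic-replicate zero a = refl
  evalMonic-replicate (suc n) a = trans (⊕-identityˡ _) (cong (a ·_) (evalMonic-replicate n a))

  evalBits-monic : ∀ {e} (v : Vec Bool e) a → evalBits (monic v) a ≡ evalMonic (List.map bit (toList v)) a
  evalBits-monic [] a = solve 1 (λ a → con true :+ a :* con false := con true) refl a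
  evalBits-monic (b ∷ v) a = cong (λ z → bit b ⊕ (a · z)) (evalBits-monic v a)

  ^2^-fixed≤ : ∀ {xs} i → Unique xs → All (λ x → sq^ x (suc i) ≡ x) xs → length xs ≤ 2 ^ suc i
  ^2^-fixed≤ {xs} i u fixed = go (2 ^ suc i) refl
    where
    go : ∀ N → N ≡ 2 ^ suc i → length xs ≤ N
    go zero e = ⊥-elim (<⇒≢ (m^n>0 2 (suc i)) e)
    go (suc zero) e = ⊥-elim (<⇒≢ (*-monoʳ-≤ 2 (m^n>0 2 i)) e)
    -- Writing 2^(i+1) as N + 2 exposes the coefficients 0, 1, 0, ..., 0 of X + X^(N+2) below the
    -- leading one.
    go (suc (suc N)) e = subst (λ z → length xs ≤ suc (suc z)) (length-replicate N)
      (roots≤degree (0# ∷ 1# ∷ List.replicate N 0#) u (All.map root fixed))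
      where
      root : ∀ {x} → sq^ x (suc i) ≡ x → evalMonic (0# ∷ 1# ∷ List.replicate N 0#) x ≡ 0#
      root {x} h = trans (solve 2 (λ x p → con false :+ x :* (con true :+ x :* p) := x :+ x :* (x :* p)) refl x _)
        (trans (cong (x ⊕_) (trans (cong (λ z → x · (x · z)) (evalMonic-replicate N x))
          (trans (cong (pow x) e) (trans (sym (sq^≡pow x (suc i))) h)))) (⊕-self x))

-- The quotient of 𝔽₂[X] by an irreducible polynomial

module Quotient {e} (v : Vec Bool e) (irr : Irreducible v) where
  open PolySolver

  red : Poly → Z2^ e
  red = rem v

  -- The difference of two remainders is a multiple of `monic v` of smaller degree, hence 0.
  red-unique : ∀ p a → monic v ∣ p +ₚ low a → red p ≡ a
  red-unique p a h = ⊕≡0⇒≡ (∣low⇒0 v (red p ⊕ a) (∣-congʳ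
    (≈-trans (solve 3 (λ p r a → (p :+ a) :+ (p :+ r) := r :+ a) ≈-refl p (low (red p)) (low a)) (≈-reflexive (sym (low-⊕ (red p) a))))
    (∣-+ h (rem-∣ v p))))

  red-cong-∣ : ∀ p q → monic v ∣ p +ₚ q → red p ≡ red q
  red-cong-∣ p q h = red-unique p (red q) (∣-congʳ (solve 3 (λ p q r → (p :+ q) :+ (q :+ r) := p :+ r) ≈-refl p q (low (red q))) (∣-+ h (rem-∣ v q)))

  red-cong : ∀ {p q} → p ≈ q → red p ≡ red q
  red-cong {p} {q} h = red-cong-∣ p q (∣-congʳ (≈-sym (≈-trans (+ₚ-cong h (≈-refl {q})) (+ₚ-self q))) ∣0)

  red-low : ∀ a → red (low a) ≡ a
  red-low a = red-unique (low a) a (∣-congʳ (≈-sym (+ₚ-self (low a))) ∣0)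

  red-injective-∣ : ∀ p q → red p ≡ red q → monic v ∣ p +ₚ q
  red-injective-∣ p q h = ∣-congʳ
    (≈-trans (+ₚ-cong (≈-reflexive (cong (λ z → p +ₚ low z) h)) (≈-refl {q +ₚ low (red q)}))
      (solve 3 (λ p q r → (p :+ r) :+ (q :+ r) := p :+ q) ≈-refl p q (low (red q))))
    (∣-+ (rem-∣ v p) (rem-∣ v q))

  red-+ : ∀ p q → red (p +ₚ q) ≡ red p ⊕ red q
  red-+ p q = red-unique (p +ₚ q) (red p ⊕ red q) (∣-congʳ
    (≈-trans (solve 4 (λ p q r s → (p :+ r) :+ (q :+ s) := (p :+ q) :+ (r :+ s)) ≈-refl p q (low (red p)) (low (red q)))
      (≈-reflexive (cong (p +ₚ q +ₚ_) (sym (low-⊕ (red p) (red q))))))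
    (∣-+ (rem-∣ v p) (rem-∣ v q)))

  infixl 25 _·_
  _·_ : Z2^ e → Z2^ e → Z2^ e
  a · b = red (low a *ₚ low b)

  red-* : ∀ p q → red (p *ₚ q) ≡ red p · red q
  red-* p q = red-cong-∣ (p *ₚ q) (low (red p) *ₚ low (red q)) (∣-congʳ
    (solve 4 (λ p q r s → q :* (p :+ r) :+ r :* (q :+ s) := p :* q :+ r :* s) ≈-refl p q (low (red p)) (low (red q)))
    (∣-+ (∣-*ˡ q (rem-∣ v p)) (∣-*ˡ (low (red p)) (rem-∣ v q))))

  quotientField : BinaryField e
  quotientField = record
    { _·_ = _·_
    ; 1# = red 1ₚ
    ; ·-assoc = λ a b c → begin
        (a · b) · c                       ≡⟨ cong ((a · b) ·_) (red-low c) ⟨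
        (a · b) · red (low c)             ≡⟨ red-* (low a *ₚ low b) (low c) ⟨
        red ((low a *ₚ low b) *ₚ low c)   ≡⟨ red-cong (*ₚ-assoc (low a) (low b) (low c)) ⟩
        red (low a *ₚ (low b *ₚ low c))   ≡⟨ red-* (low a) (low b *ₚ low c) ⟩
        red (low a) · (b · c)             ≡⟨ cong (_· (b · c)) (red-low a) ⟩
        a · (b · c)                       ∎
    ; ·-comm = λ a b → red-cong (*ₚ-comm (low a) (low b))
    ; ·-identityˡ = λ a → begin
        red 1ₚ · a                ≡⟨ cong (red 1ₚ ·_) (red-low a) ⟨
        red 1ₚ · red (low a)      ≡⟨ red-* 1ₚ (low a) ⟨
        red (1ₚ *ₚ low a)         ≡⟨ red-cong (*ₚ-identityˡ (low a)) ⟩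
        red (low a)               ≡⟨ red-low a ⟩
        a                         ∎
    ; ·-distribʳ = λ a b c → begin
        red (low (b ⊕ c) *ₚ low a)            ≡⟨ cong (λ z → red (z *ₚ low a)) (low-⊕ b c) ⟩
        red ((low b +ₚ low c) *ₚ low a)       ≡⟨ red-cong (*ₚ-distribʳ (low a) (low b) (low c)) ⟩
        red (low b *ₚ low a +ₚ low c *ₚ low a) ≡⟨ red-+ (low b *ₚ low a) (low c *ₚ low a) ⟩
        (b · a) ⊕ (c · a)                     ∎
    ; ·-inverse = inv
    ; 1≢0 = λ h → irreducible∤1 irr (rem≡0⇒∣ v 1ₚ h)
    }
    where
    open ≡-Reasoning
    inv : ∀ a → a ≢ 0# → ∃[ b ] b · a ≡ red 1ₚ
    inv a a≢0 with inverse irr (low a) (λ h → a≢0 (∣low⇒0 v a h))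
    ... | s , h = red s , (begin
      red s · a             ≡⟨ cong (red s ·_) (red-low a) ⟨
      red s · red (low a)   ≡⟨ red-* s (low a) ⟨
      red (s *ₚ low a)      ≡⟨ red-cong-∣ (s *ₚ low a) 1ₚ h ⟩
      red 1ₚ                ∎)

  open FieldTheory quotientField hiding (solve; _:+_; _:*_; _:=_; con)

  x : Z2^ e
  x = red X

  sq^-red : ∀ p i → sq^ (red p) i ≡ red (p ^2^ i)
  sq^-red p zero = refl
  sq^-red p (suc i) = trans (cong₂ _·_ (sq^-red p i) (sq^-red p i)) (sym (red-* (p ^2^ i) (p ^2^ i)))

  bit≡red : ∀ b → bit b ≡ red (b ∷ [])
  bit≡red true = refl
  bit≡red false = red-cong (≈-sym false∷[])

  -- So `x` is a root of `monic v`, and every element of the quotient is a polynomial in `x`.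
  evalBits-x : ∀ p → evalBits p x ≡ red p
  evalBits-x [] = refl
  evalBits-x (b ∷ p) = begin
    bit b ⊕ (x · evalBits p x)      ≡⟨ cong₂ _⊕_ (bit≡red b) (cong (x ·_) (evalBits-x p)) ⟩
    red (b ∷ []) ⊕ (x · red p)      ≡⟨ cong (red (b ∷ []) ⊕_) (red-* X p) ⟨
    red (b ∷ []) ⊕ red (X *ₚ p)     ≡⟨ red-+ (b ∷ []) (X *ₚ p) ⟨
    red ((b ∷ []) +ₚ X *ₚ p)        ≡⟨ red-cong (+ₚ-cong (≈-refl {b ∷ []}) (∷-cong (*ₚ-identityˡ p))) ⟩
    red ((b ∷ []) +ₚ (false ∷ p))   ≡⟨ cong red (∷-split b p) ⟨
    red (b ∷ p)                     ∎
    where open ≡-Reasoning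

  module _ (j : ℕ) (v∣ : monic v ∣ X+X^2^ j) where

    x-fixed : sq^ x (suc j) ≡ x
    x-fixed = trans (sq^-red X (suc j)) (sym (red-cong-∣ X (X ^2^ suc j) v∣))

    all-fixed : ∀ a → sq^ a (suc j) ≡ a
    all-fixed a = subst (λ z → sq^ z (suc j) ≡ z) (trans (evalBits-x (low a)) (red-low a))
      (trans (sq^-evalBits (low a) x (suc j)) (cong (evalBits (low a)) x-fixed))

    degree≤ : e ≤ suc j
    degree≤ with e ≤? suc j
    ... | yes l = l
    ... | no l = ⊥-elim (<⇒≱ (^-monoʳ-< 2 ≤-refl (≰⇒> l))
      (subst (_≤ 2 ^ suc j) (length-allVecs e) (^2^-fixed≤ j (allVecs-unique e) (All.universal all-fixed _))))

    module _ (v∤ : ∀ i → i < j → ¬ (monic v ∣ X+X^2^ i)) where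

      -- Frobenius is injective, so a coincidence shifts down to x = x^(2^(l-i)), which makes
      -- `monic v` divide one of the excluded smaller polynomials.
      orbit-injective : ∀ {i l} → i < l → l < suc j → sq^ x i ≢ sq^ x l
      orbit-injective {i} {l} i<l (s≤s l≤j) h with m≤n⇒∃[o]m+o≡n i<l
      ... | d , refl = v∤ d (≤-trans (s≤s (m≤n+m d i)) l≤j) (red-injective-∣ X (X ^2^ suc d) (trans fixed (sq^-red X (suc d))))
        where
        fixed : x ≡ sq^ x (suc d)
        fixed = sq^-injective i (trans h (trans (cong (sq^ x) (sym (+-suc i d))) (sq^-+ x i (suc d))))

      suc≤degree : suc j ≤ e
      suc≤degree = subst₂ _≤_ (length-applyUpTo (sq^ x) (suc j)) (trans (length-map bit (toList v)) (length-toList v))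
        (roots≤degree (List.map bit (toList v)) (Uniqueₚ.applyUpTo⁺₁ (sq^ x) (suc j) orbit-injective)
          (Allₚ.applyUpTo⁺₂ (sq^ x) (suc j) λ i → trans (sym (evalBits-monic v (sq^ x i))) (trans (sym (sq^-evalBits (monic v) x i))
            (trans (cong (λ z → sq^ z i) (trans (evalBits-x (monic v)) (∣⇒rem≡0 v (monic v) ∣-refl))) (sq^-bit false i)))))

finiteField : ∀ j → ∃[ F ] (∀ a → FieldTheory.sq^ {suc j} F a (suc j) ≡ a)
finiteField j = build (primitiveFactor j)
  where
  build : ∃[ e ] ∃[ v ] (Irreducible {e} v × monic v ∣ X+X^2^ j × (∀ i → i < j → ¬ (monic v ∣ X+X^2^ i))) →
    ∃[ F ] (∀ a → FieldTheory.sq^ {suc j} F a (suc j) ≡ a)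
  build (e , v , irr , v∣ , v∤) with ≤-antisym (Quotient.degree≤ v irr j v∣) (Quotient.suc≤degree v irr j v∣ v∤)
  ... | refl = Quotient.quotientField v irr , Quotient.all-fixed v irr j v∣

-- The cubic curve

remove∈ : ∀ {A : Set} {x y : A} {ys} (p : x ∈ ys) → y ∈ ys → y ≢ x → y ∈ (ys Any.─ p)
remove∈ (here refl) (here refl) y≢x = ⊥-elim (y≢x refl)
remove∈ (here refl) (there q) y≢x = q
remove∈ (there p) (here e) y≢x = here e
remove∈ (there p) (there q) y≢x = there (remove∈ p q y≢x)

length-─ : ∀ {A : Set} {x : A} {ys} (p : x ∈ ys) → length ys ≡ suc (length (ys Any.─ p))
length-─ (here refl) = refl
length-─ (there p) = cong suc (length-─ p)

unique-⊆⇒length≤ : ∀ {A : Set} {xs ys : List A} → Unique xs → (∀ {x} → x ∈ xs → x ∈ ys) → length xs ≤ length ys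
unique-⊆⇒length≤ {xs = []} _ _ = z≤n
unique-⊆⇒length≤ {xs = x ∷ xs} {ys} (x∉ ∷ u) sub = subst (suc (length xs) ≤_) (sym (length-─ x∈ys))
  (s≤s (unique-⊆⇒length≤ u λ y∈ → remove∈ x∈ys (sub (there y∈)) λ e → All.lookup x∉ y∈ (sym e)))
  where x∈ys = sub (here refl)

module Cubic (i : ℕ) (F : BinaryField (suc (i * 2))) (fermat : ∀ a → FieldTheory.sq^ F a (suc (i * 2)) ≡ a) where
  open BinaryField F
  open FieldTheory F

  K : Set
  K = Z2^ (suc (i * 2))

  cube : K → K
  cube a = a · a · a

  -- `a` to the power 1 + 4 + ⋯ + 4^j.
  cubeRootPow : K → ℕ → K
  cubeRootPow a zero = a
  cubeRootPow a (suc j) = a · sq^ (cubeRootPow a j) 2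

  cubeRootPow-spec : ∀ a j → cube (cubeRootPow a j) · a ≡ sq^ a (2 + j * 2)
  cubeRootPow-spec a zero = solve 1 (λ a → a :* a :* a :* a := (a :* a) :* (a :* a)) refl a
  cubeRootPow-spec a (suc j) = trans
    (solve 2 (λ a c → let q = (c :* c) :* (c :* c) ; d = c :* c :* c :* a in
      (a :* q) :* (a :* q) :* (a :* q) :* a := (d :* d) :* (d :* d)) refl a (cubeRootPow a j))
    (cong (λ z → (z · z) · (z · z)) (cubeRootPow-spec a j))

  -- For a field of 2^(2i+1) elements, 3 (1 + 4 + ⋯ + 4^i) = 4^(i+1) - 1 ≡ 1 modulo 2^(2i+1) - 1.
  cubeRoot : ∀ a → a ≢ 0# → ∃[ b ] cube b ≡ a
  cubeRoot a a≢0 = cubeRootPow a i , ·-cancelˡ a a≢0 (trans (·-comm a _)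
    (trans (cubeRootPow-spec a i) (cong₂ _·_ (fermat a) (fermat a))))

  -- With σ = a + b, the identity a³ + b³ = σ³ + σab shows that σ ≠ 0 and the sum of the cubes
  -- determine ab. Both pairs are then the roots of one quadratic.
  cube-sidon : ∀ {a b c d} → a ≢ b → a ⊕ b ≡ c ⊕ d → cube a ⊕ cube b ≡ cube c ⊕ cube d →
    (a ≡ c × b ≡ d) ⊎ (a ≡ d × b ≡ c)
  cube-sidon {a} {b} {c} {d} a≢b sum cubes = conclude ((a ⊕ c) ≟ᵥ 0#)
    where
    open ≡-Reasoning
    factor : ∀ a b → cube a ⊕ cube b ≡ cube (a ⊕ b) ⊕ ((a ⊕ b) · (a · b))
    factor a b = solve 2 (λ a b → let s = a :+ b in a :* a :* a :+ b :* b :* b := s :* s :* s :+ s :* (a :* b)) refl a b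
    products : a · b ≡ c · d
    products = ·-cancelˡ (a ⊕ b) (λ h → a≢b (⊕≡0⇒≡ h)) (begin
      (a ⊕ b) · (a · b)                                         ≡⟨ solve 2 (λ x y → y := x :+ (x :+ y)) refl (cube (a ⊕ b)) _ ⟩
      cube (a ⊕ b) ⊕ (cube (a ⊕ b) ⊕ ((a ⊕ b) · (a · b)))       ≡⟨ cong (cube (a ⊕ b) ⊕_) (factor a b) ⟨
      cube (a ⊕ b) ⊕ (cube a ⊕ cube b)                          ≡⟨ cong₂ (λ x y → cube x ⊕ y) sum cubes ⟩
      cube (c ⊕ d) ⊕ (cube c ⊕ cube d)                          ≡⟨ cong (cube (c ⊕ d) ⊕_) (factor c d) ⟩
      cube (c ⊕ d) ⊕ (cube (c ⊕ d) ⊕ ((c ⊕ d) · (c · d)))       ≡⟨ solve 2 (λ x y → x :+ (x :+ y) := y) refl (cube (c ⊕ d)) _ ⟩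
      (c ⊕ d) · (c · d)                                         ≡⟨ cong (_· (c · d)) sum ⟨
      (a ⊕ b) · (c · d)                                         ∎)
    root : (a ⊕ c) · (a ⊕ d) ≡ 0#
    root = begin
      (a ⊕ c) · (a ⊕ d)                      ≡⟨ solve 3 (λ a c d → (a :+ c) :* (a :+ d) := a :* a :+ a :* (c :+ d) :+ c :* d) refl a c d ⟩
      ((a · a) ⊕ (a · (c ⊕ d))) ⊕ (c · d)    ≡⟨ cong₂ (λ x y → ((a · a) ⊕ (a · x)) ⊕ y) sum products ⟨
      ((a · a) ⊕ (a · (a ⊕ b))) ⊕ (a · b)    ≡⟨ solve 2 (λ a b → a :* a :+ a :* (a :+ b) :+ a :* b := con false) refl a b ⟩
      0#                                     ∎
    other : ∀ {a b c d : K} → a ⊕ b ≡ c ⊕ d → a ≡ c → b ≡ d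
    other {a} {b} {_} {d} h refl = trans (solve 2 (λ a b → b := a :+ (a :+ b)) refl a b)
      (trans (cong (a ⊕_) h) (solve 2 (λ a b → a :+ (a :+ b) := b) refl a d))
    conclude : Dec (a ⊕ c ≡ 0#) → (a ≡ c × b ≡ d) ⊎ (a ≡ d × b ≡ c)
    conclude (yes e) = inj₁ (⊕≡0⇒≡ e , other sum (⊕≡0⇒≡ e))
    conclude (no n) = inj₂ (a≡d , other (trans sum (⊕-comm c d)) a≡d)
      where
      a≡d : a ≡ d
      a≡d = ⊕≡0⇒≡ (·≡0 root n)

  infixl 25 _÷_
  -- Division by 0 gives 0, which makes `ratio` total, so that it can be mapped over a list.
  _÷_ : K → K → K
  b ÷ a with a ≟ᵥ 0#
  ... | yes _ = 0#
  ... | no a≢0 = proj₁ (·-inverse a a≢0) · b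

  ÷-unique : ∀ {a b c} → a ≢ 0# → a · c ≡ b → c ≡ b ÷ a
  ÷-unique {a} {b} {c} a≢0 refl with a ≟ᵥ 0#
  ... | yes a≡0 = ⊥-elim (a≢0 a≡0)
  ... | no a≢0 = sym (trans (sym (·-assoc _ a c)) (trans (cong (_· c) (proj₂ (·-inverse a a≢0))) (·-identityˡ c)))

  -- Counting the triples with given sum and sum of cubes

  module Scan (s t : K) where

    Triple : K → K → K → Set
    Triple a b c = (a ⊕ b) ⊕ c ≡ s × (cube a ⊕ cube b) ⊕ cube c ≡ t

    Completes : List K → K → Set
    Completes pre c = Any (λ a → Any (λ b → Triple a b c) pre) pre

    triple? : ∀ a b c → Dec (Triple a b c)
    triple? a b c = (((a ⊕ b) ⊕ c) ≟ᵥ s) ×-dec (((cube a ⊕ cube b) ⊕ cube c) ≟ᵥ t)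

    completes? : ∀ pre c → Dec (Completes pre c)
    completes? pre c = any? (λ a → any? (λ b → triple? a b c) pre) pre

    -- the number of triples closed while the points of cs are added one by one to pre
    completing : List K → List K → ℕ
    completing pre [] = 0
    completing pre (c ∷ cs) with completes? pre c
    ... | yes _ = suc (completing (c ∷ pre) cs)
    ... | no _ = completing (c ∷ pre) cs

    -- A triple has at most these six ratios; hence the 6 in all later bounds.
    orderedPairs : K → K → K → List (K × K)
    orderedPairs a b c = (a , b) ∷ (b , a) ∷ (b , c) ∷ (c , b) ∷ (c , a) ∷ (a , c) ∷ []

    pairs : List K → List K → List (K × K)
    pairs pre [] = []
    pairs pre (c ∷ cs) with completes? pre c
    ... | yes w = orderedPairs (proj₁ (satisfied w)) (proj₁ (satisfied (proj₂ (satisfied w)))) c ++ pairs (c ∷ pre) cs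
    ... | no _ = pairs (c ∷ pre) cs

    length-pairs : ∀ pre cs → length (pairs pre cs) ≡ completing pre cs * 6
    length-pairs pre [] = refl
    length-pairs pre (c ∷ cs) with completes? pre c
    ... | yes _ = cong (6 +_) (length-pairs (c ∷ pre) cs)
    ... | no _ = length-pairs (c ∷ pre) cs

  module Target (s t : K) (t≢s³ : t ≢ cube s) where

    open Scan s t

    rotate : ∀ {a b c} → Triple a b c → Triple b c a
    rotate {a} {b} {c} (h , h′) =
      trans (rot a b c) h , trans (rot (cube a) (cube b) (cube c)) h′
      where
      rot : ∀ a b c → (b ⊕ c) ⊕ a ≡ (a ⊕ b) ⊕ c
      rot a b c = trans (⊕-comm _ a) (sym (⊕-assoc a b c))

    -- Equal points cancel in characteristic 2 and leave s = c and t = c³.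
    distinct : ∀ {a b c} → Triple a b c → a ≢ b
    distinct {a} {b} {c} (h , h′) refl = t≢s³ (trans (sym h′) (trans (collapse (cube a) (cube c)) (cong cube (trans (sym (collapse a c)) h))))
      where
      collapse : ∀ a c → (a ⊕ a) ⊕ c ≡ c
      collapse a c = trans (cong (_⊕ c) (⊕-self a)) (⊕-identityˡ c)

    -- By the Sidon property one point determines the rest of its triple, so different triples are
    -- disjoint and an added point closes at most one.
    triple-unique : ∀ {a b a′ b′ c} → Triple a b c → Triple a′ b′ c → (a ≡ a′ × b ≡ b′) ⊎ (a ≡ b′ × b ≡ a′)
    triple-unique {a} {b} {a′} {b′} {c} v@(h , k) (h′ , k′) = cube-sidon (distinct v)
      (cancel (trans h (sym h′))) (cancel (trans k (sym k′)))
      where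
      cancel : ∀ {x y z : K} → x ⊕ z ≡ y ⊕ z → x ≡ y
      cancel {x} {y} {z} e = trans (sym (⊕-cancelʳ x z)) (trans (cong (_⊕ z) e) (⊕-cancelʳ y z))

    ratioTriple : ∀ {x u} → x ≢ 0# → cube x · ((u · u) ⊕ u) ≡ t ⊕ cube s →
      Triple (s ⊕ x) (s ⊕ (x · u)) (s ⊕ (x · (u ⊕ 1#))) × u ≡ ((s ⊕ (x · u)) ⊕ s) ÷ ((s ⊕ x) ⊕ s)
    ratioTriple {x} {u} x≢0 h = (sums , trans cubes (trans (cong (cube s ⊕_) h) (solve 2 (λ c t → c :+ (t :+ c) := t) refl (cube s) t))) ,
      ÷-unique (λ e → x≢0 (trans (sym (shift x)) e)) (trans (cong (_· u) (shift x)) (sym (shift (x · u))))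
      where
      shift : ∀ y → (s ⊕ y) ⊕ s ≡ y
      shift y = solve 2 (λ s y → (s :+ y) :+ s := y) refl s y
      sums : ((s ⊕ x) ⊕ (s ⊕ (x · u))) ⊕ (s ⊕ (x · (u ⊕ 1#))) ≡ s
      sums = solve 3 (λ s x u → (s :+ x) :+ (s :+ x :* u) :+ (s :+ x :* (u :+ con true)) := s) refl s x u
      cubes : (cube (s ⊕ x) ⊕ cube (s ⊕ (x · u))) ⊕ cube (s ⊕ (x · (u ⊕ 1#))) ≡ cube s ⊕ (cube x · ((u · u) ⊕ u))
      cubes = solve 3 (λ s x u → let c = λ a → a :* a :* a in
        c (s :+ x) :+ c (s :+ x :* u) :+ c (s :+ x :* (u :+ con true)) := c s :+ c x :* (u :* u :+ u)) refl s x u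

    solveCubic : ∀ {v} → v ≢ 0# → ∃[ x ] (x ≢ 0# × cube x · v ≡ t ⊕ cube s)
    solveCubic {v} v≢0 = x , x≢0 , x³v≡c
      where
      c d : K
      c = t ⊕ cube s
      d = proj₁ (·-inverse v v≢0)
      dv≡1 : d · v ≡ 1#
      dv≡1 = proj₂ (·-inverse v v≢0)
      c≢0 : c ≢ 0#
      c≢0 e = t≢s³ (⊕≡0⇒≡ e)
      d≢0 : d ≢ 0#
      d≢0 e = 1≢0 (trans (sym dv≡1) (trans (cong (_· v) e) (zeroˡ v)))
      root = cubeRoot (d · c) (·≢0 d≢0 c≢0)
      x : K
      x = proj₁ root
      x³v≡c : cube x · v ≡ c
      x³v≡c = trans (cong (_· v) (proj₂ root)) (trans (solve 3 (λ c d v → (d :* c) :* v := (d :* v) :* c) refl c d v)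
        (trans (cong (_· c) dv≡1) (·-identityˡ c)))
      x≢0 : x ≢ 0#
      x≢0 e = c≢0 (trans (sym x³v≡c) (trans (cong (λ z → cube z · v) e)
        (solve 1 (λ v → (con false :* con false :* con false) :* v := con false) refl v)))

    -- Here u² + u = u(u + 1) is not 0, so x³ = (t + s³) / (u² + u) can be solved for x. The
    -- excluded values 0 and 1 account for the 2 in `completing-bound`.
    tripleOfRatio : ∀ u → u ≢ 0# → u ≢ 1# → ∃[ p ] ∃[ q ] ∃[ w ] (Triple p q w × u ≡ (q ⊕ s) ÷ (p ⊕ s))
    tripleOfRatio u u≢0 u≢1 = _ , _ , _ , ratioTriple (proj₁ (proj₂ sol)) (proj₂ (proj₂ sol))
      where
      sol : ∃[ x ] (x ≢ 0# × cube x · ((u · u) ⊕ u) ≡ t ⊕ cube s)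
      sol = solveCubic λ h → ·≢0 u≢0 (λ e → u≢1 (⊕≡0⇒≡ e))
        (trans (solve 1 (λ u → u :* (u :+ con true) := u :* u :+ u) refl u) h)

    _∈?_ : ∀ (x : K) xs → Dec (x ∈ xs)
    x ∈? xs = any? (x ≟ᵥ_) xs

    mutual-pairs : ∀ {p q w a b c} → Triple p q w → Triple a b c → (c ≡ p ⊎ c ≡ q ⊎ c ≡ w) → (p , q) ∈ orderedPairs a b c
    mutual-pairs T U (inj₂ (inj₂ refl)) with triple-unique T U
    ... | inj₁ (refl , refl) = here refl
    ... | inj₂ (refl , refl) = there (here refl)
    mutual-pairs T U (inj₁ refl) with triple-unique (rotate T) U
    ... | inj₁ (refl , refl) = there (there (there (there (here refl))))
    ... | inj₂ (refl , refl) = there (there (there (here refl)))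
    mutual-pairs T U (inj₂ (inj₁ refl)) with triple-unique (rotate (rotate T)) U
    ... | inj₁ (refl , refl) = there (there (here refl))
    ... | inj₂ (refl , refl) = there (there (there (there (there (here refl)))))

    Known : List K → List K → K → Set
    Known pre cs x = x ∈ pre ⊎ x ∈ cs

    advance : ∀ {pre c cs x} → Known pre (c ∷ cs) x → Known (c ∷ pre) cs x
    advance (inj₁ m) = inj₁ (there m)
    advance (inj₂ (here e)) = inj₁ (here e)
    advance (inj₂ (there m)) = inj₂ m

    lastPoint : ∀ {p q w c pre} → Triple p q w → ¬ (p ∈ pre × q ∈ pre × w ∈ pre) →
      p ∈ c ∷ pre → q ∈ c ∷ pre → w ∈ c ∷ pre → (c ≡ p ⊎ c ≡ q ⊎ c ≡ w) × Completes pre c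
    lastPoint T fresh (there p) (there q) (there w) = ⊥-elim (fresh (p , q , w))
    lastPoint T fresh (here refl) (here refl) _ = ⊥-elim (distinct T refl)
    lastPoint T fresh _ (here refl) (here refl) = ⊥-elim (distinct (rotate T) refl)
    lastPoint T fresh (here refl) _ (here refl) = ⊥-elim (distinct (rotate (rotate T)) refl)
    lastPoint T fresh (there p) (there q) (here refl) = inj₂ (inj₂ refl) , lose p (lose q T)
    lastPoint T fresh (here refl) (there q) (there w) = inj₁ refl , lose q (lose w (rotate T))
    lastPoint T fresh (there p) (here refl) (there w) = inj₂ (inj₁ refl) , lose w (lose p (rotate (rotate T)))

    -- A triple is recorded when the last of its points moves into `pre`; the negated hypothesis
    -- says that this has not yet happened. The pair found there may list the points in another
    -- order, which the six ordered pairs absorb.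
    pairs-complete : ∀ {p q w} pre cs → Triple p q w → ¬ (p ∈ pre × q ∈ pre × w ∈ pre) →
      Known pre cs p → Known pre cs q → Known pre cs w → (p , q) ∈ pairs pre cs
    pairs-complete pre [] T fresh (inj₁ p) (inj₁ q) (inj₁ w) = ⊥-elim (fresh (p , q , w))
    pairs-complete {p} {q} {w} pre (c ∷ cs) T fresh kp kq kw
      with (p ∈? (c ∷ pre)) ×-dec ((q ∈? (c ∷ pre)) ×-dec (w ∈? (c ∷ pre))) | completes? pre c
    ... | no fresh′ | yes h = ∈-++⁺ʳ (orderedPairs _ _ c) (pairs-complete (c ∷ pre) cs T fresh′ (advance kp) (advance kq) (advance kw))
    ... | no fresh′ | no _ = pairs-complete (c ∷ pre) cs T fresh′ (advance kp) (advance kq) (advance kw)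
    ... | yes (mp , mq , mw) | no n = ⊥-elim (n (proj₂ (lastPoint T fresh mp mq mw)))
    ... | yes (mp , mq , mw) | yes h = ∈-++⁺ˡ (mutual-pairs T (proj₂ (satisfied (proj₂ (satisfied h)))) (proj₁ (lastPoint T fresh mp mq mw)))

    ratio : K × K → K
    ratio (p , q) = (q ⊕ s) ÷ (p ⊕ s)

    triple-ratio : ∀ cs {p q w} → (∀ x → x ∈ cs) → Triple p q w → ratio (p , q) ∈ List.map ratio (pairs [] cs)
    triple-ratio cs {p} {q} {w} all T = ∈-map⁺ ratio (pairs-complete [] cs T (λ { (() , _) }) (inj₂ (all p)) (inj₂ (all q)) (inj₂ (all w)))

    every-ratio : ∀ cs → (∀ x → x ∈ cs) → ∀ u → u ∈ 0# ∷ 1# ∷ List.map ratio (pairs [] cs)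
    every-ratio cs all u = go (u ≟ᵥ 0#) (u ≟ᵥ 1#)
      where
      go : Dec (u ≡ 0#) → Dec (u ≡ 1#) → u ∈ 0# ∷ 1# ∷ List.map ratio (pairs [] cs)
      go (yes e) _ = here e
      go (no _) (yes e) = there (here e)
      go (no u≢0) (no u≢1) = there (there (fromTriple (tripleOfRatio u u≢0 u≢1)))
        where
        fromTriple : ∃[ p ] ∃[ q ] ∃[ w ] (Triple p q w × u ≡ ratio (p , q)) → u ∈ List.map ratio (pairs [] cs)
        fromTriple (p , q , w , T , e) = subst (_∈ List.map ratio (pairs [] cs)) (sym e) (triple-ratio cs all T)

    completing-bound : 2 ^ suc (i * 2) ≤ 2 + completing [] (allVecs _) * 6
    completing-bound = subst₂ _≤_ (length-allVecs (suc (i * 2)))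
      (cong (2 +_) (trans (length-map ratio (pairs [] (allVecs _))) (length-pairs [] (allVecs _))))
      (unique-⊆⇒length≤ (allVecs-unique _) (λ {u} _ → every-ratio (allVecs _) ∈-allVecs u))

-- Colouring by conditional expectations

pigeonhole : ∀ {A : Set} (g : A → ℕ) xs {B} → sum (map g xs) < length xs * B → ∃[ x ] g x < B
pigeonhole g (x ∷ xs) {B} h with g x <? B
... | yes l = x , l
... | no l = pigeonhole g xs (+-cancelˡ-< B _ _ (≤-<-trans (+-monoˡ-≤ _ (≮⇒≥ l)) h))

sum-map-+ : ∀ {A : Set} (g h : A → ℕ) xs → sum (map (λ x → g x + h x) xs) ≡ sum (map g xs) + sum (map h xs)
sum-map-+ g h [] = refl
sum-map-+ g h (x ∷ xs) = trans (cong (g x + h x +_) (sum-map-+ g h xs)) (lem (g x) (h x) _ _)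
  where
  lem : ∀ a b c d → a + b + (c + d) ≡ a + c + (b + d)
  lem = solve-∀

sum-map-const : ∀ {A : Set} c (xs : List A) → sum (map (λ _ → c) xs) ≡ length xs * c
sum-map-const c [] = refl
sum-map-const c (x ∷ xs) = cong (c +_) (sum-map-const c xs)

sum-map-≤ : ∀ {A : Set} {g h : A → ℕ} → (∀ x → g x ≤ h x) → ∀ xs → sum (map g xs) ≤ sum (map h xs)
sum-map-≤ l [] = z≤n
sum-map-≤ l (x ∷ xs) = +-mono-≤ (l x) (sum-map-≤ l xs)

sum-map-0 : ∀ {A : Set} (xs : List A) → sum (map (λ _ → 0) xs) ≡ 0
sum-map-0 xs = trans (sum-map-const 0 xs) (*-zeroʳ (length xs))

whenNot : ∀ {P : Set} → Dec P → ℕ → ℕ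
whenNot (yes _) n = 0
whenNot (no _) n = n

whenNot-≤ : ∀ {P : Set} (P? : Dec P) n → whenNot P? n ≤ n
whenNot-≤ (yes _) n = z≤n
whenNot-≤ (no _) n = ≤-refl

whenNot-yes : ∀ {P : Set} (P? : Dec P) n → P → whenNot P? n ≡ 0
whenNot-yes (yes _) n p = refl
whenNot-yes (no ¬p) n p = ⊥-elim (¬p p)

-- At least the summand of `x` vanishes.
sum-whenNot : ∀ {A : Set} {P : A → Set} (P? : ∀ x → Dec (P x)) n {x} xs → x ∈ xs → P x →
  sum (map (λ y → whenNot (P? y) n) xs) ≤ pred (length xs) * n
sum-whenNot P? n (x ∷ xs) (here refl) p = subst (λ z → z + sum (map (λ y → whenNot (P? y) n) xs) ≤ length xs * n) (sym (whenNot-yes (P? x) n p))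
  (≤-trans (sum-map-≤ (λ y → whenNot-≤ (P? y) n) xs) (≤-reflexive (sum-map-const n xs)))
sum-whenNot P? n (x ∷ xs@(_ ∷ _)) (there m) p = +-mono-≤ (whenNot-≤ (P? x) n) (sum-whenNot P? n xs m p)

sum-filter-∁ : ∀ {A : Set} {P : A → Set} (P? : ∀ x → Dec (P x)) (g : A → ℕ) x xs →
  sum (map g (filter (¬? ∘ P?) (x ∷ xs))) ≡ whenNot (P? x) (g x) + sum (map g (filter (¬? ∘ P?) xs))
sum-filter-∁ P? g x xs with P? x
... | yes _ = refl
... | no _ = refl

find² : ∀ {A : Set} (P : A → A → Set) {xs} → Any (λ a → Any (P a) xs) xs → ∃[ a ] ∃[ b ] (a ∈ xs × b ∈ xs × P a b)
find² P h with find h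
... | a , a∈ , h′ with find h′
... | b , b∈ , p = a , b , a∈ , b∈ , p

module Colouring (i : ℕ) (F : BinaryField (suc (i * 2))) (fermat : ∀ a → FieldTheory.sq^ F a (suc (i * 2)) ≡ a) (r : ℕ) where
  open Cubic i F fermat
  open Scan

  -- 2^r - 1, the number of colours of a closing point that miss the demand.
  q : ℕ
  q = pred (length (allVecs r))

  Demand : Set
  Demand = K × K × Z2^ r

  factor : ∀ {P : Set} → Dec P → ℕ
  factor (yes _) = q
  factor (no _) = length (allVecs r)

  -- The method of conditional expectations: if the points of pre have their colours and d is
  -- not yet met, weight pre cs d counts the colourings of cs that leave d unmet: a point
  -- closes at most one triple of (s, t), and then exactly one of its colours meets d.
  weight : List K → List K → Demand → ℕ
  weight pre [] _ = 1
  weight pre (c ∷ cs) d@(s , t , _) = factor (completes? s t pre c) * weight (c ∷ pre) cs d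

  -- With Q = 2^r and D closings, the weight is Q^|cs| (q/Q)^D; the denominator is cleared.
  weight-completing : ∀ pre cs s t w → weight pre cs (s , t , w) * length (allVecs r) ^ completing s t pre cs
    ≡ q ^ completing s t pre cs * length (allVecs r) ^ length cs
  weight-completing pre [] s t w = refl
  weight-completing pre (c ∷ cs) s t w with completes? s t pre c
  ... | yes _ = trans (lem q _ _ _) (trans (cong ((q * length (allVecs r)) *_) (weight-completing (c ∷ pre) cs s t w)) (lem′ q (length (allVecs r)) (q ^ completing s t (c ∷ pre) cs) _))
    where
    lem : ∀ q W Q x → q * W * (Q * x) ≡ q * Q * (W * x)
    lem = solve-∀
    lem′ : ∀ q Q x y → q * Q * (x * y) ≡ q * x * (Q * y)
    lem′ = solve-∀
  ... | no _ = trans (*-assoc (length (allVecs r)) _ _) (trans (cong (length (allVecs r) *_) (weight-completing (c ∷ pre) cs s t w)) (lem (length (allVecs r)) (q ^ completing s t (c ∷ pre) cs) _))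
    where
    lem : ∀ Q x y → Q * (x * y) ≡ x * (Q * y)
    lem = solve-∀

  Hit : (K → Z2^ r) → Demand → Set
  Hit f (s , t , w) = ∃[ a ] ∃[ b ] ∃[ c ] (Triple s t a b c × (f a ⊕ f b) ⊕ f c ≡ w)

  HitAt : (K → Z2^ r) → List K → K → Demand → Z2^ r → Set
  HitAt f pre c (s , t , w) y = Any (λ a → Any (λ b → Triple s t a b c × (f a ⊕ f b) ⊕ y ≡ w) pre) pre

  hitAt? : ∀ f pre c d y → Dec (HitAt f pre c d y)
  hitAt? f pre c (s , t , w) y = any? (λ a → any? (λ b → triple? s t a b c ×-dec (((f a ⊕ f b) ⊕ y) ≟ᵥ w)) pre) pre

  completes⇒hitAt : ∀ f pre c s t w → Completes s t pre c → ∃[ y ] HitAt f pre c (s , t , w) y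
  completes⇒hitAt f pre c s t w h with find² (λ a b → Triple s t a b c) h
  ... | a , b , a∈ , b∈ , T = (f a ⊕ f b) ⊕ w , lose a∈ (lose b∈ (T , trans (sym (⊕-assoc _ _ w)) (trans (cong (_⊕ w) (⊕-self (f a ⊕ f b))) (⊕-identityˡ w))))

  unmet : (K → Z2^ r) → List K → K → List Demand → Z2^ r → List Demand
  unmet f pre c ds y = filter (λ d → ¬? (hitAt? f pre c d y)) ds

  average-one : ∀ f pre c d n → sum (map (λ y → whenNot (hitAt? f pre c d y) n) (allVecs r))
    ≤ factor (completes? (proj₁ d) (proj₁ (proj₂ d)) pre c) * n
  average-one f pre c d@(s , t , w) n with completes? s t pre c
  ... | yes h = sum-whenNot (hitAt? f pre c d) n (allVecs r) (∈-allVecs _) (proj₂ (completes⇒hitAt f pre c s t w h))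
  ... | no _ = ≤-trans (sum-map-≤ (λ y → whenNot-≤ (hitAt? f pre c d y) n) (allVecs r)) (≤-reflexive (sum-map-const n (allVecs r)))

  -- The total is additive in the demands. One for which `c` closes a triple survives at most `q`
  -- colours, any other at most all of them; `factor` charges exactly this.
  average : ∀ f pre c cs ds → sum (map (λ y → sum (map (weight (c ∷ pre) cs) (unmet f pre c ds y))) (allVecs r))
    ≤ sum (map (weight pre (c ∷ cs)) ds)
  average f pre c cs [] = ≤-reflexive (sum-map-0 (allVecs r))
  average f pre c cs (d ∷ ds) = begin
    sum (map (λ y → sum (map W (unmet f pre c (d ∷ ds) y))) (allVecs r))
      ≤⟨ sum-map-≤ (λ y → ≤-reflexive (sum-filter-∁ (λ d → hitAt? f pre c d y) W d ds)) (allVecs r) ⟩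
    sum (map (λ y → whenNot (hitAt? f pre c d y) (W d) + sum (map W (unmet f pre c ds y))) (allVecs r))
      ≡⟨ sum-map-+ (λ y → whenNot (hitAt? f pre c d y) (W d)) (λ y → sum (map W (unmet f pre c ds y))) (allVecs r) ⟩
    sum (map (λ y → whenNot (hitAt? f pre c d y) (W d)) (allVecs r)) + sum (map (λ y → sum (map W (unmet f pre c ds y))) (allVecs r))
      ≤⟨ +-mono-≤ (average-one f pre c d (W d)) (average f pre c cs ds) ⟩
    weight pre (c ∷ cs) d + sum (map (weight pre (c ∷ cs)) ds) ∎
    where
    open ≤-Reasoning
    W = weight (c ∷ pre) cs

  assign : (K → Z2^ r) → K → Z2^ r → K → Z2^ r
  assign f c y x with x ≟ᵥ c
  ... | yes _ = y
  ... | no _ = f x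

  assign-same : ∀ f c y → assign f c y c ≡ y
  assign-same f c y with c ≟ᵥ c
  ... | yes _ = refl
  ... | no n = ⊥-elim (n refl)

  assign-other : ∀ f c y {x} → x ≢ c → assign f c y x ≡ f x
  assign-other f c y {x} x≢c with x ≟ᵥ c
  ... | yes e = ⊥-elim (x≢c e)
  ... | no _ = refl

  -- Colours are final only outside `cs`; the values of `f` on `cs` are placeholders.
  Extension : (K → Z2^ r) → List K → List Demand → Set
  Extension f cs ds = Σ (K → Z2^ r) λ f′ → (∀ x → x ∉ cs → f′ x ≡ f x) × (∀ d → d ∈ ds → Hit f′ d)

  extend : ∀ f pre c cs ds y → c ∉ cs → (∀ x → x ∈ pre → x ∉ c ∷ cs) →
    Extension (assign f c y) cs (unmet f pre c ds y) → Extension f (c ∷ cs) ds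
  extend f pre c cs ds y fresh disj (f′ , same , hits) = f′ ,
    (λ x x∉ → trans (same x (x∉ ∘ there)) (assign-other f c y (x∉ ∘ here))) ,
    λ d d∈ds → hit d d∈ds (hitAt? f pre c d y)
    where
    f′-pre : ∀ x → x ∈ pre → f′ x ≡ f x
    f′-pre x m = trans (same x (λ m′ → disj x m (there m′))) (assign-other f c y (λ e → disj x m (here e)))
    hit : ∀ d → d ∈ ds → Dec (HitAt f pre c d y) → Hit f′ d
    hit d d∈ds (no n) = hits d (∈-filter⁺ (λ d → ¬? (hitAt? f pre c d y)) d∈ds n)
    hit (s , t , w) d∈ds (yes h) with find² (λ a b → Triple s t a b c × (f a ⊕ f b) ⊕ y ≡ w) h
    ... | a , b , a∈ , b∈ , T , e = a , b , c , T ,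
      trans (cong₂ _⊕_ (cong₂ _⊕_ (f′-pre a a∈) (f′-pre b b∈)) (trans (same c fresh) (assign-same f c y))) e

  -- The weight stays below the number of colourings of `cs`: by averaging, some colour of the next
  -- point preserves this. At the end every weight is 1 and so is the bound, hence no demand is
  -- left.
  colouring : ∀ pre cs f ds → Unique cs → (∀ x → x ∈ pre → x ∉ cs) →
    sum (map (weight pre cs) ds) < length (allVecs r) ^ length cs → Extension f cs ds
  colouring pre [] f [] u disj h = f , (λ _ _ → refl) , λ _ ()
  colouring pre [] f (d ∷ ds) u disj (s≤s ())
  colouring pre (c ∷ cs) f ds (c∉cs ∷ u) disj h = choose (pigeonhole remaining (allVecs r) (≤-<-trans (average f pre c cs ds) h))
    where
    remaining : Z2^ r → ℕ
    remaining y = sum (map (weight (c ∷ pre) cs) (unmet f pre c ds y))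
    fresh : c ∉ cs
    fresh m = All.lookup c∉cs m refl
    disj′ : ∀ x → x ∈ c ∷ pre → x ∉ cs
    disj′ x (here refl) m = fresh m
    disj′ x (there m) m′ = disj x m (there m′)
    choose : ∃[ y ] remaining y < length (allVecs r) ^ length cs → Extension f (c ∷ cs) ds
    choose (y , l) = extend f pre c cs ds y fresh disj (colouring (c ∷ pre) cs (assign f c y) (unmet f pre c ds y) u disj′ l)

-- Greedy extension of Sidon sets

sidon-⊆ : ∀ {n} {S T : List (Z2^ n)} → S ⊆ₛ T → IsSidon T → IsSidon S
sidon-⊆ S⊆T sidon a b x y = sidon (S⊆T a) (S⊆T b) (S⊆T x) (S⊆T y)

_∈?_ : ∀ {n} (v : Z2^ n) S → Dec (v ∈ S)
v ∈? S = any? (v ≟ᵥ_) S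

sidon? : ∀ {n} (S : List (Z2^ n)) → Dec (IsSidon S)
sidon? {n} S = map′
  (λ h a b x y → All.lookup (All.lookup (All.lookup (All.lookup h a) b) x) y)
  (λ h → All.tabulate λ a → All.tabulate λ b → All.tabulate λ x → All.tabulate λ y → h a b x y)
  (all? (λ a → all? (λ b → all? (λ x → all? (λ y →
    ¬? (a ≟ᵥ b) →-dec (¬? (x ≟ᵥ y) →-dec (((a ⊕ b) ≟ᵥ (x ⊕ y)) →-dec
      (((a ≟ᵥ x) ×-dec (b ≟ᵥ y)) ⊎-dec ((a ≟ᵥ y) ×-dec (b ≟ᵥ x)))))) S) S) S) S)

record SidonExtension {n} (S candidates : List (Z2^ n)) : Set where
  field
    T : List (Z2^ n)
    S⊆T : S ⊆ₛ T
    T-unique : Unique T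
    T-sidon : IsSidon T
    saturated : ∀ {v} → v ∈ candidates → v ∉ T → ¬ IsSidon (v ∷ T)
open SidonExtension

∷-⊆ : ∀ {n} {v : Z2^ n} {S T} → S ⊆ₛ T → (v ∷ S) ⊆ₛ (v ∷ T)
∷-⊆ h (here e) = here e
∷-⊆ h (there m) = there (h m)

-- One pass is enough: subsets of Sidon sets are Sidon, so a rejected candidate stays rejected as
-- the set grows.
greedy : ∀ {n} (S vs : List (Z2^ n)) → Unique S → IsSidon S → SidonExtension S vs
greedy S [] u s = record { T = S ; S⊆T = id ; T-unique = u ; T-sidon = s ; saturated = λ () }
greedy S (v ∷ vs) u s with v ∈? S | sidon? (v ∷ S)
... | yes v∈S | _ = record { SidonExtension rest ; saturated = λ
    { (here refl) v∉T → ⊥-elim (v∉T (S⊆T rest v∈S)) ; (there m) → saturated rest m } }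
  where rest = greedy S vs u s
... | no v∉S | yes s′ = record { SidonExtension rest ; S⊆T = S⊆T rest ∘ there ; saturated = λ
    { (here refl) v∉T → ⊥-elim (v∉T (S⊆T rest (here refl))) ; (there m) → saturated rest m } }
  where rest = greedy (v ∷ S) vs (Allₚ.¬Any⇒All¬ S v∉S ∷ u) s′
... | no v∉S | no ¬s′ = record { SidonExtension rest ; saturated = λ
    { (here refl) _ sT → ¬s′ (sidon-⊆ (∷-⊆ (S⊆T rest)) sT) ; (there m) → saturated rest m } }
  where rest = greedy S vs u s

maximalExtension : ∀ {n} (S : List (Z2^ n)) → Unique S → IsSidon S →
  ∃[ T ] (S ⊆ₛ T × Unique T × IsMaximalSidon T)
maximalExtension {n} S u s = T E , S⊆T E , T-unique E , T-sidon E , maximal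
  where
  E = greedy S (allVecs n) u s
  maximal : ∀ T′ → T E ⊂ₛ T′ → IsSidon T′ → ⊥
  maximal T′ (sub , v , v∈T′ , v∉T) sT′ = saturated E (∈-allVecs v) v∉T (sidon-⊆ (λ { (here refl) → v∈T′ ; (there m) → sub m }) sT′)

-- Lifting the curve

bernoulli : ∀ q n → q ^ suc n + suc n * q ^ n ≤ suc q ^ suc n
bernoulli q zero = ≤-reflexive (lem q)
  where
  lem : ∀ q → q * 1 + 1 ≡ 1 + q * 1
  lem = solve-∀
bernoulli q (suc n) = ≤-trans (m≤m+n _ (suc n * q ^ n)) (≤-trans (≤-reflexive (lem q n (q ^ n))) (*-monoʳ-≤ (suc q) (bernoulli q n)))
  where
  lem : ∀ q n x → q * (q * x) + suc (suc n) * (q * x) + suc n * x ≡ suc q * (q * x + suc n * x)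
  lem = solve-∀

2*^≤suc^ : ∀ q → 2 * q ^ suc q ≤ suc q ^ suc q
2*^≤suc^ q = ≤-trans (≤-trans (≤-reflexive (cong (q ^ suc q +_) (+-identityʳ _))) (+-monoʳ-≤ (q ^ suc q) (*-monoˡ-≤ (q ^ q) (n≤1+n q)))) (bernoulli q q)

-- With Q = q + 1 this is (1 - 1/Q)^n ≤ 2^-a for n ≥ aQ; each block of Q factors gains a 2 by
-- Bernoulli's inequality.
2^*^≤suc^ : ∀ q a {n} → a * suc q ≤ n → 2 ^ a * q ^ n ≤ suc q ^ n
2^*^≤suc^ q a {n} l with m≤n⇒∃[o]m+o≡n l
... | o , refl = begin
  2 ^ a * q ^ (a * suc q + o)                   ≡⟨ cong (2 ^ a *_) (^-distribˡ-+-* q (a * suc q) o) ⟩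
  2 ^ a * (q ^ (a * suc q) * q ^ o)             ≡⟨ *-assoc (2 ^ a) _ _ ⟨
  2 ^ a * q ^ (a * suc q) * q ^ o               ≤⟨ *-mono-≤ (go a) (^-monoˡ-≤ o (n≤1+n q)) ⟩
  suc q ^ (a * suc q) * suc q ^ o               ≡⟨ ^-distribˡ-+-* (suc q) (a * suc q) o ⟨
  suc q ^ (a * suc q + o)                       ∎
  where
  open ≤-Reasoning
  lem : ∀ x y z → 2 * x * (y * z) ≡ 2 * y * (x * z)
  lem = solve-∀
  go : ∀ a → 2 ^ a * q ^ (a * suc q) ≤ suc q ^ (a * suc q)
  go zero = ≤-refl
  go (suc a) = begin
    2 * 2 ^ a * q ^ (suc q + a * suc q)                 ≡⟨ cong (2 * 2 ^ a *_) (^-distribˡ-+-* q (suc q) (a * suc q)) ⟩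
    2 * 2 ^ a * (q ^ suc q * q ^ (a * suc q))           ≡⟨ lem (2 ^ a) (q ^ suc q) _ ⟩
    2 * q ^ suc q * (2 ^ a * q ^ (a * suc q))           ≤⟨ *-mono-≤ (2*^≤suc^ q) (go a) ⟩
    suc q ^ suc q * suc q ^ (a * suc q)                 ≡⟨ ^-distribˡ-+-* (suc q) (suc q) (a * suc q) ⟨
    suc q ^ (suc q + a * suc q)                         ∎

sum-bound : ∀ {A : Set} (g : A → ℕ) b c xs → (∀ x → x ∈ xs → b * g x ≤ c) → b * sum (map g xs) ≤ length xs * c
sum-bound g b c [] h = ≤-reflexive (*-zeroʳ b)
sum-bound g b c (x ∷ xs) h = subst (_≤ c + length xs * c) (sym (*-distribˡ-+ b (g x) _))
  (+-mono-≤ (h x (here refl)) (sum-bound g b c xs λ y m → h y (there m)))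

module Lift (i : ℕ) (F : BinaryField (suc (i * 2))) (fermat : ∀ a → FieldTheory.sq^ F a (suc (i * 2)) ≡ a) (r : ℕ) where
  open Cubic i F fermat
  open Colouring i F fermat r
  open Scan

  k m : ℕ
  k = suc (i * 2)
  m = k + (k + r)

  coords : Z2^ m → Demand
  coords v = take k v , take k (drop k v) , drop k (drop k v)

  fromCoords : Demand → Z2^ m
  fromCoords (s , t , w) = s Vec.++ (t Vec.++ w)

  from-coords : ∀ v → fromCoords (coords v) ≡ v
  from-coords v = trans (cong (take k v Vec.++_) (take++drop≡id k (drop k v))) (take++drop≡id k v)

  fromCoords-injective : ∀ s t w s′ t′ w′ → fromCoords (s , t , w) ≡ fromCoords (s′ , t′ , w′) → s ≡ s′ × t ≡ t′ × w ≡ w′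
  fromCoords-injective s t w s′ t′ w′ e with ++-injective s s′ e
  ... | es , e′ = es , ++-injective t t′ e′

  fromCoords-⊕ : ∀ s t w s′ t′ w′ → fromCoords (s , t , w) ⊕ fromCoords (s′ , t′ , w′) ≡ fromCoords (s ⊕ s′ , t ⊕ t′ , w ⊕ w′)
  fromCoords-⊕ s t w s′ t′ w′ = trans (zipWith-++ _xor_ s _ s′ _) (cong ((s ⊕ s′) Vec.++_) (zipWith-++ _xor_ t w t′ w′))

  OffCurve : Demand → Set
  OffCurve (s , t , w) = t ≢ cube s

  offCurve? : ∀ d → Dec (OffCurve d)
  offCurve? (s , t , w) = ¬? (t ≟ᵥ cube s)

  demands : List Demand
  demands = filter offCurve? (map coords (allVecs m))

  length-demands : length demands ≤ 2 ^ m
  length-demands = ≤-trans (length-filter offCurve? (map coords (allVecs m)))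
    (≤-reflexive (trans (length-map coords (allVecs m)) (length-allVecs m)))

  module _ (large : 2 + suc m * 2 ^ r * 6 ≤ 2 ^ k) where

    suc-q : suc q ≡ length (allVecs r)
    suc-q = suc-pred (length (allVecs r)) {{>-nonZero (subst (0 <_) (sym (length-allVecs r)) (m^n>0 2 r))}}

    -- `large` is shaped to cancel the 2 and the 6 of `completing-bound`. What remains is m + 1
    -- blocks of 2^r closings, worth a factor 2^-(m+1).
    many-completing : ∀ s t → t ≢ cube s → suc m * suc q ≤ completing s t [] (allVecs k)
    many-completing s t t≢s³ = *-cancelʳ-≤ _ _ 6 (+-cancelˡ-≤ 2 _ _ (≤-trans
      (subst (λ z → 2 + suc m * z * 6 ≤ 2 ^ k) (sym (trans suc-q (length-allVecs r))) large)
      (Target.completing-bound s t t≢s³)))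

    weight-bound : ∀ d → OffCurve d → 2 ^ suc m * weight [] (allVecs k) d ≤ length (allVecs r) ^ length (allVecs k)
    weight-bound (s , t , w) t≢s³ = *-cancelʳ-≤ (2 ^ suc m * W) M (Q ^ D) {{Q^D≢0}} (begin
      2 ^ suc m * W * Q ^ D       ≡⟨ *-assoc (2 ^ suc m) W _ ⟩
      2 ^ suc m * (W * Q ^ D)     ≡⟨ cong (2 ^ suc m *_) (weight-completing [] (allVecs k) s t w) ⟩
      2 ^ suc m * (q ^ D * M)     ≡⟨ *-assoc (2 ^ suc m) (q ^ D) M ⟨
      2 ^ suc m * q ^ D * M       ≤⟨ *-monoˡ-≤ M (subst (λ z → 2 ^ suc m * q ^ D ≤ z ^ D) suc-q (2^*^≤suc^ q (suc m) (many-completing s t t≢s³))) ⟩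
      Q ^ D * M                   ≡⟨ *-comm (Q ^ D) M ⟩
      M * Q ^ D                   ∎)
      where
      open ≤-Reasoning
      Q D W M : ℕ
      Q = length (allVecs r)
      D = completing s t [] (allVecs k)
      W = weight [] (allVecs k) (s , t , w)
      M = Q ^ length (allVecs k)
      Q^D≢0 : NonZero (Q ^ D)
      Q^D≢0 = subst (λ z → NonZero (z ^ D)) suc-q (m^n≢0 (suc q) D)

    -- The union bound: at most 2^m demands, each failing with probability at most 2^-(m+1). The
    -- spare factor 2 makes the inequality strict.
    total-weight : sum (map (weight [] (allVecs k)) demands) < length (allVecs r) ^ length (allVecs k)
    total-weight = halve (*-cancelˡ-≤ (2 ^ m) {{m^n≢0 2 m}} (begin
      2 ^ m * (2 * Σw)        ≡⟨ lem (2 ^ m) Σw ⟩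
      2 ^ suc m * Σw          ≤⟨ sum-bound (weight [] (allVecs k)) (2 ^ suc m) M demands (λ d d∈ → weight-bound d (proj₂ (∈-filter⁻ offCurve? {xs = map coords (allVecs m)} d∈))) ⟩
      length demands * M      ≤⟨ *-monoˡ-≤ M length-demands ⟩
      2 ^ m * M               ∎))
      where
      open ≤-Reasoning
      M Σw : ℕ
      M = length (allVecs r) ^ length (allVecs k)
      Σw = sum (map (weight [] (allVecs k)) demands)
      lem : ∀ x y → x * (2 * y) ≡ 2 * x * y
      lem = solve-∀
      M>0 : 0 < M
      M>0 = subst (λ z → 0 < z ^ length (allVecs k)) suc-q (m^n>0 (suc q) (length (allVecs k)))
      halve : ∀ {x} → 2 * x ≤ M → x < M
      halve {zero} _ = M>0
      halve {suc x} l = <-≤-trans (m<m+n (suc x) (s≤s z≤n)) l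

    coveringLift : Σ (K → Z2^ r) λ f → ∀ v → OffCurve (coords v) → Hit f (coords v)
    coveringLift with colouring [] (allVecs k) (λ _ → 0#) demands (allVecs-unique k) (λ _ ()) total-weight
    ... | f , _ , hits = f , λ v off → hits (coords v) (∈-filter⁺ offCurve? (∈-map⁺ coords (∈-allVecs v)) off)

  module _ (f : K → Z2^ r) (covers : ∀ v → OffCurve (coords v) → Hit f (coords v)) where

    point : K → Z2^ m
    point x = fromCoords (x , cube x , f x)

    point-injective : ∀ x y → point x ≡ point y → x ≡ y
    point-injective x y e = ++-injectiveˡ x y e

    points : List (Z2^ m)
    points = map point (allVecs k)

    point∈points : ∀ x → point x ∈ points
    point∈points x = ∈-map⁺ point (∈-allVecs x)

    points-unique : Unique points
    points-unique = Uniqueₚ.map⁺ (λ {x} {y} → point-injective x y) (allVecs-unique k)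

    points-sidon : IsSidon points
    points-sidon a∈ b∈ x∈ y∈ with ∈-map⁻ point a∈ | ∈-map⁻ point b∈ | ∈-map⁻ point x∈ | ∈-map⁻ point y∈
    ... | a , _ , refl | b , _ , refl | x , _ , refl | y , _ , refl = λ a≢b _ e → lift a b x y (λ h → a≢b (cong point h))
      (fromCoords-injective (a ⊕ b) (cube a ⊕ cube b) (f a ⊕ f b) (x ⊕ y) (cube x ⊕ cube y) (f x ⊕ f y) (trans (sym (fromCoords-⊕ a (cube a) (f a) b (cube b) (f b))) (trans e (fromCoords-⊕ x (cube x) (f x) y (cube y) (f y)))))
      where
      lift : ∀ a b x y → a ≢ b → (a ⊕ b ≡ x ⊕ y × cube a ⊕ cube b ≡ cube x ⊕ cube y × f a ⊕ f b ≡ f x ⊕ f y) →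
        (point a ≡ point x × point b ≡ point y) ⊎ (point a ≡ point y × point b ≡ point x)
      lift a b x y a≢b (h , h′ , _) with cube-sidon a≢b h h′
      ... | inj₁ (refl , refl) = inj₁ (refl , refl)
      ... | inj₂ (refl , refl) = inj₂ (refl , refl)

    coords-point : ∀ v x → v ≡ point x → proj₁ (coords v) ≡ x × proj₁ (proj₂ (coords v)) ≡ cube x × proj₂ (proj₂ (coords v)) ≡ f x
    coords-point v x e = fromCoords-injective (take k v) (take k (drop k v)) (drop k (drop k v)) x (cube x) (f x) (trans (from-coords v) e)

    module _ (S : List (Z2^ m)) (points⊆S : points ⊆ₛ S) (unique : Unique S) (sidon : IsSidon S) where

      -- Otherwise `v` is a sum of three points a, b, c of the lift, and v + a = b + c contradicts
      -- the Sidon property, since `v` itself is not in the lift.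
      onCurve : ∀ v → v ∈ S → ¬ OffCurve (coords v)
      onCurve v v∈S off with covers v off
      ... | a , b , c , T@(h , h′) , h″ = conclude (sidon v∈S (point∈S a) (point∈S b) (point∈S c) (notPoint a) (λ e → distinct (rotate T) (point-injective b c e)) sums)
        where
        open Target (proj₁ (coords v)) (proj₁ (proj₂ (coords v))) off
        point∈S : ∀ x → point x ∈ S
        point∈S x = points⊆S (point∈points x)
        notPoint : ∀ x → v ≢ point x
        notPoint x e with coords-point v x e
        ... | es , et , _ = off (trans et (cong cube (sym es)))
        shuffle : ∀ {n} {a b c v : Z2^ n} → (a ⊕ b) ⊕ c ≡ v → v ⊕ a ≡ b ⊕ c
        shuffle {a = a} {b} {c} refl = trans (cong (_⊕ a) (trans (⊕-assoc a b c) (⊕-comm a _))) (⊕-cancelʳ (b ⊕ c) a)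
        sums : v ⊕ point a ≡ point b ⊕ point c
        sums = trans (cong (_⊕ point a) (sym (from-coords v))) (trans
          (fromCoords-⊕ (take k v) (take k (drop k v)) (drop k (drop k v)) a (cube a) (f a))
          (trans (cong fromCoords (cong₂ _,_ (shuffle h) (cong₂ _,_ (shuffle h′) (shuffle h″))))
            (sym (fromCoords-⊕ b (cube b) (f b) c (cube c) (f c)))))
        conclude : (v ≡ point b × point a ≡ point c) ⊎ (v ≡ point c × point a ≡ point b) → ⊥
        conclude (inj₁ (e , _)) = notPoint b e
        conclude (inj₂ (e , _)) = notPoint c e

      base : Z2^ m → K
      base v = proj₁ (coords v)

      height : Z2^ m → Z2^ r
      height v = proj₂ (proj₂ (coords v))

      -- Two elements of S over the same base point x differ by (0, 0, d), and by the
      -- Sidon property every d ≠ 0 occurs for at most one element besides point x.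
      code : Z2^ m → K ⊎ Z2^ r
      code v with height v ≟ᵥ f (base v)
      ... | yes _ = inj₁ (base v)
      ... | no _ = inj₂ (height v ⊕ f (base v))

      curve-coords : ∀ v → v ∈ S → v ≡ fromCoords (base v , cube (base v) , height v)
      curve-coords v v∈S with proj₁ (proj₂ (coords v)) ≟ᵥ cube (base v)
      ... | yes e = trans (sym (from-coords v)) (cong (λ z → fromCoords (base v , z , height v)) e)
      ... | no off = ⊥-elim (onCurve v v∈S off)

      offset : ∀ v → v ∈ S → v ⊕ point (base v) ≡ fromCoords (0# , 0# , height v ⊕ f (base v))
      offset v v∈S = trans (cong (_⊕ point (base v)) (curve-coords v v∈S)) (trans (fromCoords-⊕ (base v) (cube (base v)) (height v) (base v) (cube (base v)) (f (base v)))
        (cong₂ (λ x y → fromCoords (x , y , height v ⊕ f (base v))) (⊕-self (base v)) (⊕-self (cube (base v)))))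

      height-point : ∀ v x → v ≡ point x → height v ≡ f (base v)
      height-point v x e with coords-point v x e
      ... | es , _ , ew = trans ew (cong f (sym es))

      code-injective : ∀ v w → v ∈ S → w ∈ S → code v ≡ code w → v ≡ w
      code-injective v w v∈S w∈S e with height v ≟ᵥ f (base v) | height w ≟ᵥ f (base w)
      ... | yes hv | yes hw = trans (curve-coords v v∈S) (trans
        (cong₂ (λ x z → fromCoords (x , cube x , z)) be (trans hv (trans (cong f be) (sym hw)))) (sym (curve-coords w w∈S)))
        where
        be = inj₁-injective e
      ... | no hv | no hw = conclude (sidon v∈S (points⊆S (point∈points (base v))) w∈S (points⊆S (point∈points (base w)))
          (λ e → hv (height-point v (base v) e)) (λ e → hw (height-point w (base w) e))
          (trans (offset v v∈S) (trans (cong (λ z → fromCoords (0# , 0# , z)) (inj₂-injective e)) (sym (offset w w∈S)))))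
        where
        conclude : (v ≡ w × point (base v) ≡ point (base w)) ⊎ (v ≡ point (base w) × point (base v) ≡ w) → v ≡ w
        conclude (inj₁ (e , _)) = e
        conclude (inj₂ (e , _)) = ⊥-elim (hv (height-point v (base w) e))

      size-bound : length S ≤ 2 ^ k + 2 ^ r
      size-bound = subst₂ _≤_ (length-map code S)
        (trans (length-++ (map inj₁ (allVecs k))) (cong₂ _+_ (trans (length-map inj₁ (allVecs k)) (length-allVecs k)) (trans (length-map inj₂ (allVecs r)) (length-allVecs r))))
        (unique-⊆⇒length≤ (map-unique S unique (λ m → m)) (λ {x} _ → all-codes x))
        where
        all-codes : ∀ x → x ∈ map inj₁ (allVecs k) ++ map inj₂ (allVecs r)
        all-codes (inj₁ x) = ∈-++⁺ˡ (∈-map⁺ inj₁ (∈-allVecs x))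
        all-codes (inj₂ y) = ∈-++⁺ʳ (map inj₁ (allVecs k)) (∈-map⁺ inj₂ (∈-allVecs y))
        map-unique : ∀ xs → Unique xs → (∀ {x} → x ∈ xs → x ∈ S) → Unique (map code xs)
        map-unique [] [] sub = []
        map-unique (x ∷ xs) (x∉ ∷ u) sub = All.tabulate fresh ∷ map-unique xs u (λ m → sub (there m))
          where
          fresh : ∀ {c} → c ∈ map code xs → code x ≢ c
          fresh c∈ e with ∈-map⁻ code c∈
          ... | y , y∈ , refl = All.lookup x∉ y∈ (code-injective x y (sub (here refl)) (sub (there y∈)) e)

  smallMaximalSidon : 2 + suc m * 2 ^ r * 6 ≤ 2 ^ k → ∃[ S ] (Unique {A = Z2^ m} S × IsMaximalSidon S × length S ≤ 2 ^ k + 2 ^ r)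
  smallMaximalSidon large = build (coveringLift large)
    where
    build : (Σ (K → Z2^ r) λ f → ∀ v → OffCurve (coords v) → Hit f (coords v)) →
      ∃[ S ] (Unique {A = Z2^ m} S × IsMaximalSidon S × length S ≤ 2 ^ k + 2 ^ r)
    build (f , covers) with maximalExtension (points f covers) (points-unique f covers) (points-sidon f covers)
    ... | S , sub , u , max = S , u , max , size-bound f covers S sub u (proj₁ max)

-- Choice of the parameters

-- For k = 2j + 1 the number 2^(3k) = 8·64^j grows by 64 from one odd k to the next, so the desired
-- size is met only up to this factor.
powerOf64 : ∀ M → 0 < M → ∃[ j ] (M ≤ 64 ^ j × 64 ^ j ≤ 64 * M)
powerOf64 (suc zero) _ = 0 , s≤s z≤n , s≤s z≤n
powerOf64 (suc M@(suc _)) _ with powerOf64 M (s≤s z≤n)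
... | j , l , u with suc M ≤? 64 ^ j
... | yes l′ = j , l′ , ≤-trans u (*-monoʳ-≤ 64 (n≤1+n M))
... | no ¬l′ = suc j , ≤-trans (m<m+n M (s≤s z≤n)) (*-monoʳ-≤ 64 l) , *-monoʳ-≤ 64 (≤-pred (≤-trans (≰⇒> ¬l′) (n≤1+n _)))

64^≡cube : ∀ j → 64 ^ j ≡ 2 ^ (j * 2) * (2 ^ (j * 2) * 2 ^ (j * 2))
64^≡cube j = trans (^-*-assoc 2 6 j) (trans (cong (2 ^_) (lem j))
  (trans (^-distribˡ-+-* 2 (j * 2) _) (cong (2 ^ (j * 2) *_) (^-distribˡ-+-* 2 (j * 2) (j * 2)))))
  where
  lem : ∀ j → 6 * j ≡ j * 2 + (j * 2 + j * 2)
  lem = solve-∀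

square-double : ∀ c → 3 ≤ c → suc c * suc c ≤ 2 * (c * c)
square-double c l = begin
  suc c * suc c             ≡⟨ expand c ⟩
  c * c + (2 * c + 1)       ≤⟨ +-monoʳ-≤ (c * c) (+-monoʳ-≤ (2 * c) (≤-trans (s≤s z≤n) l)) ⟩
  c * c + (2 * c + c)       ≡⟨ cong (c * c +_) (collect c) ⟩
  c * c + 3 * c             ≤⟨ +-monoʳ-≤ (c * c) (*-monoˡ-≤ c l) ⟩
  c * c + c * c             ≡⟨ cong (c * c +_) (+-identityʳ (c * c)) ⟨
  2 * (c * c)               ∎
  where
  open ≤-Reasoning
  expand : ∀ c → suc c * suc c ≡ c * c + (2 * c + 1)
  expand = solve-∀
  collect : ∀ c → 2 * c + c ≡ 3 * c
  collect = solve-∀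

-- Each step doubles the right side and at most doubles the left.
square<2^ : ∀ a {b} → 2 ≤ b → a * (suc b * suc b) < 2 ^ b → ∀ i → a * (suc (i + b) * suc (i + b)) < 2 ^ (i + b)
square<2^ a 2≤b base zero = base
square<2^ a {b} 2≤b base (suc i) = begin-strict
  a * (suc c * suc c)             ≤⟨ *-monoʳ-≤ a (square-double c (s≤s (≤-trans 2≤b (m≤n+m b i)))) ⟩
  a * (2 * (c * c))               ≡⟨ swap a (c * c) ⟩
  2 * (a * (c * c))               <⟨ *-monoʳ-< 2 (square<2^ a 2≤b base i) ⟩
  2 * 2 ^ (i + b)                 ∎
  where
  open ≤-Reasoning
  c : ℕ
  c = suc (i + b)
  swap : ∀ a b → a * (2 * b) ≡ 2 * (a * b)
  swap = solve-∀

module _ (m j : ℕ) (lower : 2 * suc m * 2 ^ m ≤ 64 ^ j) (upper : 64 ^ j ≤ 64 * (2 * suc m * 2 ^ m)) where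

  private
    k y : ℕ
    k = suc (j * 2)
    y = 2 ^ (j * 2)

  -- Cubing 2^(m+1) ≤ 2^(2k) puts 8·2^(3m) below 2^(6k) = 64·(64^j)², which `upper` bounds by a
  -- multiple of (m+1)² 2^(2m). Cancelling 8·2^(2m) leaves the constant `a`.
  dimension-bound : ∀ a → 64 * 64 * 64 * 4 ≡ a * 8 → m < k + k → 2 ^ m ≤ a * (suc m * suc m)
  dimension-bound a a-def m<2k = *-cancelʳ-≤ x _ (8 * (x * x)) {{m*n≢0 8 (x * x) {{_}} {{m*n≢0 x x {{x≢0}} {{x≢0}}}}}} (begin
    x * (8 * (x * x))                                   ≡⟨ e₁ x ⟩
    2 * x * (2 * x * (2 * x))                           ≤⟨ *-mono-≤ 2x≤4y² (*-mono-≤ 2x≤4y² 2x≤4y²) ⟩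
    2 * y * (2 * y) * (2 * y * (2 * y) * (2 * y * (2 * y))) ≡⟨ e₂ y ⟩
    64 * (y * (y * y) * (y * (y * y)))                  ≡⟨ cong (λ z → 64 * (z * z)) (64^≡cube j) ⟨
    64 * (64 ^ j * 64 ^ j)                              ≤⟨ *-monoʳ-≤ 64 (*-mono-≤ upper upper) ⟩
    64 * (64 * (2 * c * x) * (64 * (2 * c * x)))        ≡⟨ e₃ 64 c x ⟩
    64 * 64 * 64 * 4 * (c * c * (x * x))                ≡⟨ cong (_* (c * c * (x * x))) a-def ⟩
    a * 8 * (c * c * (x * x))                           ≡⟨ e₄ a 8 (c * c) (x * x) ⟩
    a * (c * c) * (8 * (x * x))                    ∎)
    where
    open ≤-Reasoning
    x c : ℕ
    x = 2 ^ m
    c = suc m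
    x≢0 : NonZero x
    x≢0 = m^n≢0 2 m
    2x≤4y² : 2 * x ≤ 2 * y * (2 * y)
    2x≤4y² = ≤-trans (^-monoʳ-≤ 2 m<2k) (≤-reflexive (^-distribˡ-+-* 2 k k))
    e₁ : ∀ x → x * (8 * (x * x)) ≡ 2 * x * (2 * x * (2 * x))
    e₁ = solve-∀
    e₂ : ∀ y → 2 * y * (2 * y) * (2 * y * (2 * y) * (2 * y * (2 * y))) ≡ 64 * (y * (y * y) * (y * (y * y)))
    e₂ = solve-∀
    e₃ : ∀ a c x → a * (a * (2 * c * x) * (a * (2 * c * x))) ≡ a * a * a * 4 * (c * c * (x * x))
    e₃ = solve-∀
    e₄ : ∀ a b c x → a * b * (c * x) ≡ a * c * (b * x)
    e₄ = solve-∀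

  dimension-small : ∀ a b → 64 * 64 * 64 * 4 ≡ a * 8 → 2 ≤ b → a * (suc b * suc b) < 2 ^ b → m < k + k → m < b
  dimension-small a b a-def 2≤b base m<2k with m <? b
  ... | yes l = l
  ... | no ¬l = ⊥-elim (<⇒≱ (subst (λ z → a * (suc z * suc z) < 2 ^ z) (m∸n+n≡m (≮⇒≥ ¬l)) (square<2^ a 2≤b base (m ∸ b))) (dimension-bound a a-def m<2k))

  -- The left side is at most 8 (m+1) 2^r. Times 2^(2k) it becomes 8 (m+1) 2^m, which `lower` puts
  -- below 8·64^j = 2^(3k).
  lift-large : ∀ r → k + (k + r) ≡ m → 2 + suc m * 2 ^ r * 6 ≤ 2 ^ k
  lift-large r refl = *-cancelʳ-≤ _ _ (Y * Y) {{m*n≢0 Y Y {{Y≢0}} {{Y≢0}}}} (begin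
    (2 + suc m * R * 6) * (Y * Y)           ≤⟨ *-monoˡ-≤ (Y * Y) (+-monoˡ-≤ (suc m * R * 6) (*-monoʳ-≤ 2 (*-mono-≤ (s≤s (z≤n {m})) (m^n>0 2 r)))) ⟩
    (2 * (suc m * R) + suc m * R * 6) * (Y * Y) ≤⟨ m≤m+n _ (8 * (suc m * R * (Y * Y))) ⟩
    (2 * (suc m * R) + suc m * R * 6) * (Y * Y) + 8 * (suc m * R * (Y * Y)) ≡⟨ e₁ (suc m) R Y ⟩
    8 * (2 * suc m * (Y * (Y * R)))         ≡⟨ cong (λ z → 8 * (2 * suc m * z)) (trans (^-distribˡ-+-* 2 k (k + r)) (cong (Y *_) (^-distribˡ-+-* 2 k r))) ⟨
    8 * (2 * suc m * 2 ^ m)                 ≤⟨ *-monoʳ-≤ 8 lower ⟩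
    8 * 64 ^ j                              ≡⟨ cong (8 *_) (64^≡cube j) ⟩
    8 * (y * (y * y))                       ≡⟨ e₂ y ⟩
    Y * (Y * Y)                             ∎)
    where
    open ≤-Reasoning
    R Y : ℕ
    R = 2 ^ r
    Y = 2 ^ k
    Y≢0 : NonZero Y
    Y≢0 = m^n≢0 2 k
    e₁ : ∀ m R Y → (2 * (m * R) + m * R * 6) * (Y * Y) + 8 * (m * R * (Y * Y)) ≡ 8 * (2 * m * (Y * (Y * R)))
    e₁ = solve-∀
    e₂ : ∀ y → 8 * (y * (y * y)) ≡ 2 * y * (2 * y * (2 * y))
    e₂ = solve-∀

  -- One 64 comes from (2·2^k)³ = 64·64^j, the other from `upper`, and the 4 from 2(m + 1) ≤ 4m.
  size-cubed : ∀ {ℓ r} C → 64 * 64 * 4 ≤ C → 1 ≤ m → 2 + suc m * 2 ^ r * 6 ≤ 2 ^ k → ℓ ≤ 2 ^ k + 2 ^ r → ℓ ^ 3 ≤ C * (m * 2 ^ m)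
  size-cubed {ℓ} {r} C const≤C 1≤m large size = begin
    ℓ ^ 3                                       ≤⟨ ^-monoˡ-≤ 3 (≤-trans size (+-monoʳ-≤ (2 ^ k) 2^r≤2^k)) ⟩
    (2 * y + 2 * y) ^ 3                         ≡⟨ e₁ y ⟩
    64 * (y * (y * y))                          ≡⟨ cong (64 *_) (64^≡cube j) ⟨
    64 * 64 ^ j                                 ≤⟨ *-monoʳ-≤ 64 upper ⟩
    64 * (64 * (2 * (1 + m) * 2 ^ m))           ≤⟨ *-monoʳ-≤ 64 (*-monoʳ-≤ 64 (*-monoˡ-≤ (2 ^ m) (*-monoʳ-≤ 2 (+-monoˡ-≤ m 1≤m)))) ⟩
    64 * (64 * (2 * (m + m) * 2 ^ m))           ≡⟨ e₂ 64 m (2 ^ m) ⟩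
    64 * 64 * 4 * (m * 2 ^ m)                   ≤⟨ *-monoˡ-≤ (m * 2 ^ m) const≤C ⟩
    C * (m * 2 ^ m)                             ∎
    where
    open ≤-Reasoning
    2^r≤2^k : 2 ^ r ≤ 2 ^ k
    2^r≤2^k = ≤-trans (m≤n*m (2 ^ r) (suc m)) (≤-trans (m≤m*n _ 6) (≤-trans (m≤n+m _ 2) large))
    e₁ : ∀ y → (2 * y + 2 * y) * ((2 * y + 2 * y) * ((2 * y + 2 * y) * 1)) ≡ 64 * (y * (y * y))
    e₁ = solve-∀
    e₂ : ∀ a m x → a * (a * (2 * (m + m) * x)) ≡ a * a * 4 * (m * x)
    e₂ = solve-∀

-- `Unique` makes `length S` the cardinality, and the bound is cubed to stay in ℕ.
SmallMaximalSidon : ℕ → ℕ → Set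
SmallMaximalSidon C m = ∃[ S ] (Unique {A = Z2^ m} S × IsMaximalSidon S × length S ^ 3 ≤ C * (m * 2 ^ m))

inSmallDimension : ∀ b C n → 2 ^ (b * 3) ≤ C → suc n < b → SmallMaximalSidon C (suc n)
inSmallDimension b C n const≤C l with maximalExtension {suc n} [] [] (λ ())
... | S , _ , u , max = S , u , max , (begin
  length S ^ 3                          ≤⟨ ^-monoˡ-≤ 3 (unique-⊆⇒length≤ u (λ {v} _ → ∈-allVecs v)) ⟩
  length (allVecs (suc n)) ^ 3          ≡⟨ cong (_^ 3) (length-allVecs (suc n)) ⟩
  (2 ^ suc n) ^ 3                       ≡⟨ ^-*-assoc 2 (suc n) 3 ⟩
  2 ^ (suc n * 3)                       ≤⟨ ^-monoʳ-≤ 2 (*-monoˡ-≤ 3 (<⇒≤ l)) ⟩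
  2 ^ (b * 3)                           ≤⟨ const≤C ⟩
  C                                     ≤⟨ m≤m*n C (suc n * 2 ^ suc n) {{m*n≢0 (suc n) (2 ^ suc n) {{_}} {{m^n≢0 2 (suc n)}}}} ⟩
  C * (suc n * 2 ^ suc n)               ∎)
  where open ≤-Reasoning

inLiftedDimension : ∀ C j m → 64 * 64 * 4 ≤ C → 1 ≤ m → ∀ r → suc (j * 2) + (suc (j * 2) + r) ≡ m →
  2 * suc m * 2 ^ m ≤ 64 ^ j → 64 ^ j ≤ 64 * (2 * suc m * 2 ^ m) → SmallMaximalSidon C m
inLiftedDimension C j m const≤C 1≤m r refl lower upper =
  build (Lift.smallMaximalSidon j (proj₁ (finiteField (j * 2))) (proj₂ (finiteField (j * 2))) r large)
  where
  large = lift-large m j lower upper r refl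
  build : ∃[ S ] (Unique {A = Z2^ m} S × IsMaximalSidon S × length S ≤ 2 ^ suc (j * 2) + 2 ^ r) → SmallMaximalSidon C m
  build (S , u , max , l) = S , u , max , size-cubed m j lower upper {length S} {r} C const≤C 1≤m large l

inAnyDimension : ∀ a b C → 64 * 64 * 64 * 4 ≡ a * 8 → 2 ≤ b → a * (suc b * suc b) < 2 ^ b → 64 * 64 * 4 ≤ C → 2 ^ (b * 3) ≤ C →
  ∀ n → SmallMaximalSidon C (suc n)
inAnyDimension a b C a-def 2≤b base lifted≤C small≤C n = choose (powerOf64 (2 * suc m * 2 ^ m) (*-mono-≤ {1} {2 * suc m} (s≤s z≤n) (m^n>0 2 m)))
  where
  m : ℕ
  m = suc n
  choose : ∃[ j ] (2 * suc m * 2 ^ m ≤ 64 ^ j × 64 ^ j ≤ 64 * (2 * suc m * 2 ^ m)) → SmallMaximalSidon C m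
  choose (j , lower , upper) = split (m <? k + k)
    where
    k : ℕ
    k = suc (j * 2)
    split : Dec (m < k + k) → SmallMaximalSidon C m
    split (yes small) = inSmallDimension b C n small≤C (dimension-small m j lower upper a b a-def 2≤b base small)
    split (no ¬small) = inLiftedDimension C j m lifted≤C (s≤s z≤n) (m ∸ (k + k))
      (trans (sym (+-assoc k k _)) (m+[n∸m]≡n (≮⇒≥ ¬small))) lower upper

-- The constants are variables so that no product with a large numeral is ever unfolded.
inAllDimensions : ∀ a b C → 64 * 64 * 64 * 4 ≡ a * 8 → 2 ≤ b → a * (suc b * suc b) < 2 ^ b → 64 * 64 * 4 ≤ C → 2 ^ (b * 3) ≤ C →
  ∃[ K ] (∀ n → SmallMaximalSidon K (suc n))
inAllDimensions a b C a-def 2≤b base lifted≤C small≤C = C , inAnyDimension a b C a-def 2≤b base lifted≤C small≤C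

theorem3p1 : ∃[ K ] (∀ (n : ℕ) → ∃[ S ] (Unique {A = Z2^ (suc n)} S × IsMaximalSidon {suc n} S ×
    length S ^ 3 ≤ K * (suc n * 2 ^ suc n)))
-- 2^17 is 64³·4/8, and 32 qualifies since 33² < 2^15. Below dimension 32 the whole group has at
-- most 2^32 elements, whose cube is the second summand of the constant.
theorem3p1 = inAllDimensions (2 ^ 17) 32 (64 * 64 * 4 + 2 ^ (32 * 3)) refl (≤ᵇ⇒≤ _ _ _) (≤ᵇ⇒≤ _ _ _)
  (m≤m+n (64 * 64 * 4) (2 ^ (32 * 3))) (m≤n+m (2 ^ (32 * 3)) (64 * 64 * 4))
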